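{- Let $U=[\mathbf u]\in\mathsf{SP}(\mathsf{Act}\cup\mathsf{State})$ be a series-parallel pomset. Then $U$ is guarded (i.e. $U\in\mathcal G$) if and only if $U$ satisfies all of the conditions (A1)–(A7) listed in the context.
   Context: **Alphabet.** $\mathrm{Var},\mathrm{Val}$ are finite sets. $\mathsf{State}$ is the set of partial functions $\alpha:\mathrm{Var}\rightharpoonup\mathrm{Val}$ with domain $\mathrm{dom}(\alpha)$. $\mathsf{Act}$ is the set of formal symbols $(v\leftarrow n)$ and $(v\leftarrow v')$ with $v,v'\in\mathrm{Var}$, $n\in\mathrm{Val}$. **Pomsets.** A pomset over $\Sigma$ is an isomorphism class $[\mathbf u]$ of finite $\Sigma$-labelled posets $\mathbf u=\langle S_{\mathbf u},\le_{\mathbf u},\lambda_{\mathbf u}\rangle$; $1$ is the empty pomset, a letter denotes the corresponding one-node pomset. $U\parallel V$ is the disjoint union; $U\cdot V$ is the disjoint union with additionally every node of $U$ below every node of $V$. $\mathsf{SP}(\Sigma)$ is the smallest set of pomsets containing $1$ and all letters and closed under $\cdot$ and $\parallel$. **Guarded pomsets.** For $\alpha\in\mathsf{State}$, $a\in\mathsf{Act}$: $\alpha[a]$ exists if $a=(v\leftarrow n)$ with $n\in\mathrm{Val}$, or $a=(v\leftarrow v')$ with $v'\in\mathrm{dom}(\alpha)$; then $\alpha[v\leftarrow n]$ maps $v$ to $n$ and agrees with $\alpha$ (including undefinedness) elsewhere, and $\alpha[v\leftarrow v']$ maps $v$ to $\alpha(v')$ and agrees with $\alpha$ elsewhere. $\alpha\oplus\beta$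 is defined iff $\alpha(v)=\beta(v)$ for all $v\in\mathrm{dom}(\alpha)\cap\mathrm{dom}(\beta)$, and then equals $\alpha\cup\beta$. $\mathcal G$ is the smallest set of pomsets over $\mathsf{Act}\cup\mathsf{State}$ such that (for $\alpha,\beta,\gamma,\delta\in\mathsf{State}$, $a\in\mathsf{Act}$): $\alpha\in\mathcal G$; $\alpha\cdot a\cdot\alpha[a]\in\mathcal G$ if $\alpha[a]$ exists; if $U\cdot\alpha\in\mathcal G$ and $\alpha\cdot V\in\mathcal G$ then $U\cdot\alpha\cdot V\in\mathcal G$; if $\alpha\cdot U\cdot\beta\in\mathcal G$, $\gamma\cdot V\cdot\delta\in\mathcal G$ and $\alpha\oplus\gamma$, $\beta\oplus\delta$ are defined, then $(\alpha\oplus\gamma)\cdot(U\parallel V)\cdot(\beta\oplus\delta)\in\mathcal G$. **Nodes and paths.** For $U=[\mathbf u]$: $s'$ is the predecessor of $s$ if $s'<_{\mathbf u}s$ and every $s''<_{\mathbf u}s$ satisfies $s''\le_{\mathbf u}s'$; successor is dual. State-nodes are nodes labelled in $\mathsf{State}$; all other nodes are action-nodes. A path for $v\in\mathrm{Var}$ from a state-node $u_1$ to a state-node $u_2$, where $u_1\le_{\mathbf u}u_2$, is a sequence of nodes $q_1,a_1,q_2,\dots,a_n,q_{n+1}$ ($n\ge0$) such that: - each $a_i$ is labelled in $\mathsf{Act}$, $u_1\le_{\mathbf u}a_i\le_{\mathbf u}u_2$, and $a_i\le_{\mathbf u}a_{i+1}$ for $1\le i<n$; - each $q_i$ is a state-node,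 $q_i$ is the predecessor and $q_{i+1}$ the successor of $a_i$ for $1\le i\le n$; $q_1=u_1$, $q_{n+1}=u_2$, $v\in\mathrm{dom}(\lambda_{\mathbf u}(u_1))$; and for $1\le i\le n$, $\lambda_{\mathbf u}(q_{i+1})(v)$ equals $m$ if $\lambda_{\mathbf u}(a_i)=(v\leftarrow m)$ with $m\in\mathrm{Val}$; equals $\lambda_{\mathbf u}(q_i)(v')$ if $\lambda_{\mathbf u}(a_i)=(v\leftarrow v')$ with $v'\in\mathrm{Var}$, $v'\in\mathrm{dom}(\lambda_{\mathbf u}(q_i))$; and equals $\lambda_{\mathbf u}(q_i)(v)$ otherwise. **Conditions.** - (A1) $U$ has a unique minimum $*_{\min}$ and a unique maximum $*_{\max}$ in $S_{\mathbf u}$, both labelled by states. - (A2) Every two (distinct) related state-nodes are separated by an action-node: if $s<_{\mathbf u}s'$ are state-nodes there is an action-node $a$ with $s<_{\mathbf u}a<_{\mathbf u}s'$. - (A3) Every action-node has a predecessor and a successor, and these are state-nodes. - (A4) For every state-node $u$ and $v\in\mathrm{dom}(\lambda_{\mathbf u}(u))$ there is a path for $v$ from $u$ to $*_{\max}$. - (A5) If $\lambda_{\mathbf u}(u)=(v\leftarrow n)$ with $n\in\mathrm{Val}$, then the successor $s$ of $u$ satisfies $\lambda_{\mathbf u}(s)(v)=n$. - (A6) If $\lambda_{\mathbf u}(u)=(v\leftarrow v')$ with $v,v'\in\mathrm{Var}$ and $p,s$ are the predecessor and successor of $u$, then $v'\in\mathrm{dom}(\lambda_{\mathbf u}(p))$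 and $\lambda_{\mathbf u}(s)(v)=\lambda_{\mathbf u}(s)(v')=\lambda_{\mathbf u}(p)(v')$. - (A7) For every state-node $u$ and $v\in\mathrm{dom}(\lambda_{\mathbf u}(u))$ there is a path for $v$ from some $s\in S_{\mathbf u}$ to $u$ such that either $s=*_{\min}$ and $v\in\mathrm{dom}(\lambda_{\mathbf u}(s))$, or $s$ is the successor of a node labelled $(v\leftarrow k)$ with $k\in\mathrm{Var}\cup\mathrm{Val}$. -}

module Defs where

open import Data.Empty using (⊥)
open import Data.Fin using (Fin; zero; suc; inject₁; fromℕ; toℕ)
open import Data.Fin.Properties using (0↔⊥; 1↔⊤; +↔⊎)
open import Data.Maybe using (Maybe; just; nothing; _<∣>_)
import Data.Maybe as Maybe
open import Data.Nat using (ℕ; _+_)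
open import Data.Product using (∃; ∃!; ∃-syntax; _×_; _,_; proj₁)
open import Data.Sum using (_⊎_; inj₁; inj₂; [_,_])
open import Data.Sum.Function.Propositional using (_⊎-↔_)
open import Data.Sum.Relation.Binary.LeftOrder using (_⊎-<_; ⊎-<-isPartialOrder)
open import Data.Sum.Relation.Binary.Pointwise
  using (Pointwise; ⊎-isPartialOrder; Pointwise-≡⇒≡; ≡⇒Pointwise-≡)
open import Data.Unit using (⊤)
open import Data.Vec using (Vec; lookup; zipWith; _[_]≔_)
open import Function using (_↔_; _∘_)
open import Function.Construct.Composition using (_↔-∘_)
open import Level using (0ℓ)
open import Relation.Binary.Core using (Rel)
open import Relation.Binary.Definitions using (Minimum; Maximum)
import Relation.Binary.Construct.NonStrictToStrict as ToStrict
open import Relation.Binary.Morphism.Structures using (IsOrderIsomorphism)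
open import Relation.Binary.PropositionalEquality using (_≡_; _≢_; isEquivalence)
open import Relation.Binary.PropositionalEquality.Properties
  using () renaming (isPartialOrder to ≡-isPartialOrder)
open import Relation.Binary.Structures using (IsPartialOrder)
open import Relation.Nullary using (¬_)

------------------------------------------------------------------------
-- Pomsets

-- Pomsets are represented by finite labelled posets; the quotient by
-- isomorphism is replaced by closing every class of pomsets under _≅_.

record Pomset (A : Set) : Set₁ where
  field
    Node           : Set
    size           : ℕ
    enumeration    : Fin size ↔ Node
    _≤_            : Rel Node 0ℓ
    isPartialOrder : IsPartialOrder _≡_ _≤_
    label          : Node → A

  open ToStrict _≡_ _≤_ public using (_<_)

  IsPredecessor : Node → Node → Set
  IsPredecessor s p = p < s × (∀ t → t < s → t ≤ p)

  IsSuccessor : Node → Node → Set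
  IsSuccessor s q = s < q × (∀ t → s < t → q ≤ t)

record _≅_ {A : Set} (U V : Pomset A) : Set where
  private
    module U = Pomset U
    module V = Pomset V
  field
    to                 : U.Node → V.Node
    isOrderIsomorphism : IsOrderIsomorphism _≡_ _≡_ U._≤_ V._≤_ to
    label-to           : ∀ s → V.label (to s) ≡ U.label s

private
  fromPointwise : ∀ {A B : Set} {_≤_ : Rel (A ⊎ B) 0ℓ} →
                  IsPartialOrder (Pointwise _≡_ _≡_) _≤_ → IsPartialOrder _≡_ _≤_
  fromPointwise po = record
    { isPreorder = record
      { isEquivalence = isEquivalence
      ; reflexive     = P.reflexive ∘ ≡⇒Pointwise-≡
      ; trans         = P.trans
      }
    ; antisym = λ x≤y y≤x → Pointwise-≡⇒≡ (P.antisym x≤y y≤x)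
    }
    where module P = IsPartialOrder po

𝟏 : ∀ {A} → Pomset A
𝟏 = record
  { Node           = ⊥
  ; size           = 0
  ; enumeration    = 0↔⊥
  ; _≤_            = _≡_
  ; isPartialOrder = ≡-isPartialOrder
  ; label          = λ ()
  }

⟨_⟩ : ∀ {A} → A → Pomset A
⟨ x ⟩ = record
  { Node           = ⊤
  ; size           = 1
  ; enumeration    = 1↔⊤
  ; _≤_            = _≡_
  ; isPartialOrder = ≡-isPartialOrder
  ; label          = λ _ → x
  }

infixr 7 _·_
infixr 6 _∥_

_·_ : ∀ {A} → Pomset A → Pomset A → Pomset A
U · V = record
  { Node           = U.Node ⊎ V.Node
  ; size           = U.size + V.size
  ; enumeration    = (U.enumeration ⊎-↔ V.enumeration) ↔-∘ +↔⊎
  ; _≤_            = U._≤_ ⊎-< V._≤_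
  ; isPartialOrder = fromPointwise (⊎-<-isPartialOrder U.isPartialOrder V.isPartialOrder)
  ; label          = [ U.label , V.label ]
  }
  where module U = Pomset U
        module V = Pomset V

_∥_ : ∀ {A} → Pomset A → Pomset A → Pomset A
U ∥ V = record
  { Node           = U.Node ⊎ V.Node
  ; size           = U.size + V.size
  ; enumeration    = (U.enumeration ⊎-↔ V.enumeration) ↔-∘ +↔⊎
  ; _≤_            = Pointwise U._≤_ V._≤_
  ; isPartialOrder = fromPointwise (⊎-isPartialOrder U.isPartialOrder V.isPartialOrder)
  ; label          = [ U.label , V.label ]
  }
  where module U = Pomset U
        module V = Pomset V

data SP {A : Set} : Pomset A → Set₁ where
  one    : SP 𝟏
  letter : ∀ x → SP ⟨ x ⟩
  seq    : ∀ {U V} → SP U → SP V → SP (U · V)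
  par    : ∀ {U V} → SP U → SP V → SP (U ∥ V)
  resp-≅ : ∀ {U V} → U ≅ V → SP U → SP V

------------------------------------------------------------------------
-- Guarded pomsets over nVar variables and nVal values

module Guards (nVar nVal : ℕ) where

  Var : Set
  Var = Fin nVar

  Val : Set
  Val = Fin nVal

  -- A partial function is its vector of values, so that _≡_ on states is
  -- extensional.
  State : Set
  State = Vec (Maybe Val) nVar

  data Expr : Set where
    val : Val → Expr
    var : Var → Expr

  data Act : Set where
    _←_ : Var → Expr → Act

  data Label : Set where
    act   : Act → Label
    state : State → Label

  -- α[a]; the result is nothing exactly when α[a] does not exist.
  assign : State → Act → Maybe State
  assign α (v ← val n)  = just (α [ v ]≔ just n)
  assign α (v ← var v′) = Maybe.map (λ n → α [ v ]≔ just n) (lookup α v′)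

  Compatible : State → State → Set
  Compatible α β = ∀ v {m n} → lookup α v ≡ just m → lookup β v ≡ just n → m ≡ n

  -- α ∪ β, to be used only when α and β are Compatible (_<∣>_ prefers the
  -- left value).
  _⊕_ : State → State → State
  _⊕_ = zipWith _<∣>_

  ⟪_⟫ : State → Pomset Label
  ⟪ α ⟫ = ⟨ state α ⟩

  data Guarded : Pomset Label → Set₁ where
    g-state : ∀ α → Guarded ⟪ α ⟫
    g-act   : ∀ {α a β} → assign α a ≡ just β →
              Guarded (⟪ α ⟫ · ⟨ act a ⟩ · ⟪ β ⟫)
    g-seq   : ∀ {U V α} → Guarded (U · ⟪ α ⟫) → Guarded (⟪ α ⟫ · V) →
              Guarded (U · ⟪ α ⟫ · V)
    g-par   : ∀ {U V α β γ δ} →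
              Guarded (⟪ α ⟫ · U · ⟪ β ⟫) → Guarded (⟪ γ ⟫ · V · ⟪ δ ⟫) →
              Compatible α γ → Compatible β δ →
              Guarded (⟪ α ⊕ γ ⟫ · (U ∥ V) · ⟪ β ⊕ δ ⟫)
    resp-≅  : ∀ {U V} → U ≅ V → Guarded U → Guarded V

  module _ (U : Pomset Label) where
    open Pomset U

    IsStateNode : Node → Set
    IsStateNode s = ∃[ α ] label s ≡ state α

    IsActionNode : Node → Set
    IsActionNode s = ∃[ a ] label s ≡ act a

    -- λ(s)(v), with nothing for "undefined".  Action-nodes carry no state;
    -- they get the everywhere undefined function.
    value : Node → Var → Maybe Val
    value s v with label s
    ... | act _   = nothing
    ... | state α = lookup α v

    _∈dom_ : Var → Node → Set
    v ∈dom s = ∃[ n ] value s v ≡ just n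

    -- q 0, a 0, q 1, …, a (n − 1), q n
    record Path (v : Var) (u₁ u₂ : Node) : Set where
      field
        u₁≤u₂ : u₁ ≤ u₂
        n     : ℕ
        q     : Fin (ℕ.suc n) → Node
        a     : Fin n → Node

        a-action  : ∀ i → IsActionNode (a i)
        u₁≤a      : ∀ i → u₁ ≤ a i
        a≤u₂      : ∀ i → a i ≤ u₂
        a-mono    : ∀ i j → toℕ j ≡ ℕ.suc (toℕ i) → a i ≤ a j

        q-state   : ∀ i → IsStateNode (q i)
        q-pred    : ∀ i → IsPredecessor (a i) (q (inject₁ i))
        q-succ    : ∀ i → IsSuccessor (a i) (q (suc i))
        q-first   : q zero ≡ u₁
        q-last    : q (fromℕ n) ≡ u₂
        v∈dom     : v ∈dom u₁

        step-val  : ∀ i m → label (a i) ≡ act (v ← val m) →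
                    value (q (suc i)) v ≡ just m
        step-var  : ∀ i v′ → label (a i) ≡ act (v ← var v′) → v′ ∈dom q (inject₁ i) →
                    value (q (suc i)) v ≡ value (q (inject₁ i)) v′
        step-else : ∀ i →
                    (∀ m → label (a i) ≢ act (v ← val m)) →
                    (∀ v′ → label (a i) ≡ act (v ← var v′) → ¬ v′ ∈dom q (inject₁ i)) →
                    value (q (suc i)) v ≡ value (q (inject₁ i)) v

    record Conditions : Set where
      field
        A1-min : ∃! _≡_ (Minimum _≤_)
        A1-max : ∃! _≡_ (Maximum _≤_)

      *min : Node
      *min = proj₁ A1-min

      *max : Node
      *max = proj₁ A1-max

      field
        A1-min-state : IsStateNode *min
        A1-max-state : IsStateNode *max

        A2 : ∀ s s′ → IsStateNode s → IsStateNode s′ → s < s′ →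
             ∃[ a ] IsActionNode a × s < a × a < s′

        A3 : ∀ a → IsActionNode a →
             (∃[ p ] IsPredecessor a p × IsStateNode p) ×
             (∃[ s ] IsSuccessor a s × IsStateNode s)

        A4 : ∀ u v → IsStateNode u → v ∈dom u → Path v u *max

        A5 : ∀ u v n → label u ≡ act (v ← val n) →
             ∀ s → IsSuccessor u s → value s v ≡ just n

        A6 : ∀ u v v′ → label u ≡ act (v ← var v′) →
             ∀ p s → IsPredecessor u p → IsSuccessor u s →
             v′ ∈dom p × value s v ≡ value s v′ × value s v′ ≡ value p v′

        A7 : ∀ u v → IsStateNode u → v ∈dom u →
             ∃[ s ] Path v s u ×
               ((s ≡ *min × v ∈dom s) ⊎
                (∃[ t ] ∃[ k ] label t ≡ act (v ← k) × IsSuccessor t s))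

-- A path exists exactly when its steps can be taken one at a time, because the order
-- is finite; so (A4) and (A7) say that every defined variable of a state-node is passed
-- on by some step out of the node and comes from some step into it.  In this one-step
-- form the conditions are stable under the operations generating the guarded pomsets.
-- Conversely, a nonempty series-parallel pomset is a chain P₁ · … · Pₖ of letters and
-- parallel compositions, and (A1) makes P₁ and Pₖ states α and β; the rest is by
-- induction.  After an inner Pᵢ comes a state: if some maximal node of Pᵢ is an action,
-- its successor is a minimum of what follows; and two distinct maximal states of Pᵢ
-- would leave a minimal node of what follows without a predecessor or unseparated
-- from them.  So the pomset can be cut at that state.  If the middle is a single
-- parallel composition U ∥ V, restrict α and β to the variables that are passed on by
-- the steps leaving α into U and entering β from U, and likewise for V: the restricted
-- pomsets satisfy the conditions again, and every variable belongs to U or to V.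

module Submission where

open import Data.Bool using (Bool; true; false)
open import Data.Empty using (⊥-elim)
open import Data.Fin using (Fin; zero; suc; inject₁; fromℕ)
import Data.Fin.Induction as Fin
import Data.Fin.Properties as Fin
open import Data.Maybe using (Maybe; just; nothing; _<∣>_)
open import Data.Maybe.Properties using (just-injective; ≡-dec)
open import Data.Nat using (ℕ; zero; suc)
open import Data.Nat.Properties using (suc-injective)
open import Data.Product using (∃; ∃-syntax; _×_; _,_; proj₁; proj₂)
open import Data.Sum using (_⊎_; inj₁; inj₂)
import Data.Sum as Sum
open import Data.Sum.Properties using (inj₂-injective)
open import Data.Sum.Relation.Binary.LeftOrder using (₁∼₂; ₁∼₁; ₂∼₂)
open import Data.Sum.Relation.Binary.Pointwise using (inj₁; inj₂)
open import Data.Unit using (⊤; tt)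
open import Data.Vec using (lookup; tabulate; _[_]≔_)
open import Data.Vec.Properties
  using (lookup∘tabulate; tabulate∘lookup; tabulate-cong; lookup-zipWith; lookup∘update; lookup∘update′)
open import Function using (_⇔_; mk⇔; Inverse; _on_; _∘_; flip; case_of_)
open import Induction.WellFounded using (WellFounded; Acc; acc)
open import Relation.Binary.Construct.On using () renaming (isPartialOrder to on-isPartialOrder)
open import Relation.Binary.Definitions using (Minimum; Maximum)
open import Relation.Binary.Morphism.Structures using (IsOrderIsomorphism)
open import Relation.Binary.PropositionalEquality
  using (_≡_; _≢_; refl; sym; trans; cong; cong₂; subst)
open import Relation.Binary.Structures using (IsPartialOrder)
open import Relation.Nullary using (¬_; Dec; yes; no; contradiction)
open import Relation.Nullary.Decidable using (map′; _⊎-dec_)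
open import Defs

-- Finite partial orders

module Po {A : Set} (U : Pomset A) where
  open Pomset U
  open IsPartialOrder isPartialOrder public using ()
    renaming (refl to ≤-refl; reflexive to ≤-reflexive; trans to ≤-trans; antisym to ≤-antisym)

  <-≤-trans : ∀ {x y z} → x < y → y ≤ z → x < z
  <-≤-trans (x≤y , x≢y) y≤z = ≤-trans x≤y y≤z , λ { refl → x≢y (≤-antisym x≤y y≤z) }

  ≤-<-trans : ∀ {x y z} → x ≤ y → y < z → x < z
  ≤-<-trans x≤y (y≤z , y≢z) = ≤-trans x≤y y≤z , λ { refl → y≢z (≤-antisym y≤z x≤y) }

  <-trans : ∀ {x y z} → x < y → y < z → x < z
  <-trans x<y (y≤z , _) = <-≤-trans x<y y≤z

  module Enum = Inverse enumeration

  -- Finiteness enters through the enumeration: the order pulled back to `Fin size` is well-founded,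
  -- and accessibility is transported to the nodes.
  <-wellFounded : WellFounded _<_
  <-wellFounded x = subst (Acc _<_) (Enum.strictlyInverseˡ x) (lift (wf (Enum.from x)))
    where
    wf : WellFounded (_<_ on Enum.to)
    wf = Fin.po-wellFounded (on-isPartialOrder Enum.to isPartialOrder)
    lift : ∀ {i} → Acc (_<_ on Enum.to) i → Acc _<_ (Enum.to i)
    lift {i} (acc rs) = acc λ {y} y<i →
      let e = Enum.strictlyInverseˡ y in
      subst (Acc _<_) e (lift (rs (subst (_< Enum.to i) (sym e) y<i)))

  >-wellFounded : WellFounded (flip _<_)
  >-wellFounded x = subst (Acc (flip _<_)) (Enum.strictlyInverseˡ x) (lift (wf (Enum.from x)))
    where
    wf : WellFounded (flip _<_ on Enum.to)
    wf = Fin.po-noetherian (on-isPartialOrder Enum.to isPartialOrder)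
    lift : ∀ {i} → Acc (flip _<_ on Enum.to) i → Acc (flip _<_) (Enum.to i)
    lift {i} (acc rs) = acc λ {y} i<y →
      let e = Enum.strictlyInverseˡ y in
      subst (Acc (flip _<_)) e (lift (rs (subst (Enum.to i <_) (sym e) i<y)))

  any? : {P : Node → Set} → (∀ x → Dec (P x)) → Dec (∃ P)
  any? {P} P? = map′ (λ { (i , p) → Enum.to i , p })
                     (λ { (x , p) → Enum.from x , subst P (sym (Enum.strictlyInverseˡ x)) p })
                     (Fin.any? (λ i → P? (Enum.to i)))

-- Isomorphisms

infix 4 _≃_

-- The same notion as `_≅_`, with an explicit inverse in place of surjectivity and cancellation, so
-- that isomorphisms can be inverted and composed directly.
record _≃_ {A : Set} (U V : Pomset A) : Set where
  private
    module U = Pomset U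
    module V = Pomset V
  field
    to        : U.Node → V.Node
    from      : V.Node → U.Node
    to-mono   : ∀ {x y} → x U.≤ y → to x V.≤ to y
    from-mono : ∀ {x y} → x V.≤ y → from x U.≤ from y
    to-from   : ∀ y → to (from y) ≡ y
    from-to   : ∀ x → from (to x) ≡ x
    label-to  : ∀ x → V.label (to x) ≡ U.label x

≃-refl : ∀ {A} {U : Pomset A} → U ≃ U
≃-refl = record
  { to = λ x → x ; from = λ x → x ; to-mono = λ p → p ; from-mono = λ p → p
  ; to-from = λ _ → refl ; from-to = λ _ → refl ; label-to = λ _ → refl }

≃-sym : ∀ {A} {U V : Pomset A} → U ≃ V → V ≃ U
≃-sym {V = V} e = record
  { to = from ; from = to ; to-mono = from-mono ; from-mono = to-mono
  ; to-from = from-to ; from-to = to-from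
  ; label-to = λ y → trans (sym (label-to (from y))) (cong (Pomset.label V) (to-from y)) }
  where open _≃_ e

≃-trans : ∀ {A} {U V W : Pomset A} → U ≃ V → V ≃ W → U ≃ W
≃-trans e f = record
  { to = F.to ∘ E.to ; from = E.from ∘ F.from
  ; to-mono = F.to-mono ∘ E.to-mono ; from-mono = E.from-mono ∘ F.from-mono
  ; to-from = λ z → trans (cong F.to (E.to-from (F.from z))) (F.to-from z)
  ; from-to = λ x → trans (cong E.from (F.from-to (E.to x))) (E.from-to x)
  ; label-to = λ x → trans (F.label-to (E.to x)) (E.label-to x) }
  where module E = _≃_ e
        module F = _≃_ f

≃⇒≅ : ∀ {A} {U V : Pomset A} → U ≃ V → U ≅ V
≃⇒≅ {U = U} {V} e = record
  { to = to
  ; isOrderIsomorphism = record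
    { isOrderMonomorphism = record
      { isOrderHomomorphism = record { cong = cong to ; mono = to-mono }
      ; injective = λ {x} {y} eq → trans (sym (from-to x)) (trans (cong from eq) (from-to y))
      ; cancel = λ {x} {y} p → subst (λ z → z U.≤ y) (from-to x) (subst (U._≤_ _) (from-to y) (from-mono p))
      }
    ; surjective = λ y → from y , λ { refl → to-from y }
    }
  ; label-to = label-to
  }
  where open _≃_ e
        module U = Pomset U

≅⇒≃ : ∀ {A} {U V : Pomset A} → U ≅ V → U ≃ V
≅⇒≃ {U = U} {V} e = record
  { to = to ; from = from ; to-mono = mono
  ; from-mono = λ {x} {y} p → cancel (subst (λ z → z V.≤ _) (sym (to-from x)) (subst (V._≤_ _) (sym (to-from y)) p))
  ; to-from = to-from ; from-to = λ x → injective (to-from (to x))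
  ; label-to = label-to }
  where open _≅_ e
        open IsOrderIsomorphism isOrderIsomorphism
        module V = Pomset V
        from : V.Node → Pomset.Node U
        from y = proj₁ (surjective y)
        to-from : ∀ y → to (from y) ≡ y
        to-from y = proj₂ (surjective y) refl

module _ {A : Set} where

  ·-cong : {U U′ V V′ : Pomset A} → U ≃ U′ → V ≃ V′ → U · V ≃ U′ · V′
  ·-cong e f = record
    { to = Sum.map E.to F.to ; from = Sum.map E.from F.from
    ; to-mono = λ { ₁∼₂ → ₁∼₂ ; (₁∼₁ p) → ₁∼₁ (E.to-mono p) ; (₂∼₂ p) → ₂∼₂ (F.to-mono p) }
    ; from-mono = λ { ₁∼₂ → ₁∼₂ ; (₁∼₁ p) → ₁∼₁ (E.from-mono p) ; (₂∼₂ p) → ₂∼₂ (F.from-mono p) }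
    ; to-from = λ { (inj₁ x) → cong inj₁ (E.to-from x) ; (inj₂ x) → cong inj₂ (F.to-from x) }
    ; from-to = λ { (inj₁ x) → cong inj₁ (E.from-to x) ; (inj₂ x) → cong inj₂ (F.from-to x) }
    ; label-to = λ { (inj₁ x) → E.label-to x ; (inj₂ x) → F.label-to x } }
    where module E = _≃_ e
          module F = _≃_ f

  ∥-cong : {U U′ V V′ : Pomset A} → U ≃ U′ → V ≃ V′ → U ∥ V ≃ U′ ∥ V′
  ∥-cong e f = record
    { to = Sum.map E.to F.to ; from = Sum.map E.from F.from
    ; to-mono = λ { (inj₁ p) → inj₁ (E.to-mono p) ; (inj₂ p) → inj₂ (F.to-mono p) }
    ; from-mono = λ { (inj₁ p) → inj₁ (E.from-mono p) ; (inj₂ p) → inj₂ (F.from-mono p) }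
    ; to-from = λ { (inj₁ x) → cong inj₁ (E.to-from x) ; (inj₂ x) → cong inj₂ (F.to-from x) }
    ; from-to = λ { (inj₁ x) → cong inj₁ (E.from-to x) ; (inj₂ x) → cong inj₂ (F.from-to x) }
    ; label-to = λ { (inj₁ x) → E.label-to x ; (inj₂ x) → F.label-to x } }
    where module E = _≃_ e
          module F = _≃_ f

  ·-assoc : (U V W : Pomset A) → (U · V) · W ≃ U · V · W
  ·-assoc U V W = record
    { to = Sum.assocʳ ; from = Sum.assocˡ
    ; to-mono = λ
      { (₁∼₂ {inj₁ _}) → ₁∼₂ ; (₁∼₂ {inj₂ _}) → ₂∼₂ ₁∼₂
      ; (₁∼₁ ₁∼₂) → ₁∼₂ ; (₁∼₁ (₁∼₁ p)) → ₁∼₁ p ; (₁∼₁ (₂∼₂ p)) → ₂∼₂ (₁∼₁ p)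
      ; (₂∼₂ p) → ₂∼₂ (₂∼₂ p) }
    ; from-mono = λ
      { (₁∼₂ {y = inj₁ _}) → ₁∼₁ ₁∼₂ ; (₁∼₂ {y = inj₂ _}) → ₁∼₂
      ; (₁∼₁ p) → ₁∼₁ (₁∼₁ p)
      ; (₂∼₂ ₁∼₂) → ₁∼₂ ; (₂∼₂ (₁∼₁ p)) → ₁∼₁ (₂∼₂ p) ; (₂∼₂ (₂∼₂ p)) → ₂∼₂ p }
    ; to-from = λ { (inj₁ _) → refl ; (inj₂ (inj₁ _)) → refl ; (inj₂ (inj₂ _)) → refl }
    ; from-to = λ { (inj₁ (inj₁ _)) → refl ; (inj₁ (inj₂ _)) → refl ; (inj₂ _) → refl }
    ; label-to = λ { (inj₁ (inj₁ _)) → refl ; (inj₁ (inj₂ _)) → refl ; (inj₂ _) → refl } }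

  module _ (U V : Pomset A) (empty : ¬ Pomset.Node U) where

    private
      drop : Pomset.Node U ⊎ Pomset.Node V → Pomset.Node V
      drop (inj₁ x) = ⊥-elim (empty x)
      drop (inj₂ y) = y

      inj₂-drop : ∀ x → Sum.inj₂ (drop x) ≡ x
      inj₂-drop (inj₁ x) = ⊥-elim (empty x)
      inj₂-drop (inj₂ _) = refl

    ·-identityˡ : V ≃ U · V
    ·-identityˡ = record
      { to = inj₂ ; from = drop ; to-mono = ₂∼₂
      ; from-mono = λ { (₁∼₂ {x}) → ⊥-elim (empty x) ; (₁∼₁ {x} _) → ⊥-elim (empty x) ; (₂∼₂ p) → p }
      ; to-from = inj₂-drop ; from-to = λ _ → refl ; label-to = λ _ → refl }

    ∥-identityˡ : V ≃ U ∥ V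
    ∥-identityˡ = record
      { to = inj₂ ; from = drop ; to-mono = inj₂
      ; from-mono = λ { (inj₁ {x} _) → ⊥-elim (empty x) ; (inj₂ p) → p }
      ; to-from = inj₂-drop ; from-to = λ _ → refl ; label-to = λ _ → refl }

  module _ (U V : Pomset A) (empty : ¬ Pomset.Node V) where

    private
      drop : Pomset.Node U ⊎ Pomset.Node V → Pomset.Node U
      drop (inj₁ x) = x
      drop (inj₂ y) = ⊥-elim (empty y)

      inj₁-drop : ∀ x → Sum.inj₁ (drop x) ≡ x
      inj₁-drop (inj₁ _) = refl
      inj₁-drop (inj₂ y) = ⊥-elim (empty y)

    ·-identityʳ : U ≃ U · V
    ·-identityʳ = record
      { to = inj₁ ; from = drop ; to-mono = ₁∼₁
      ; from-mono = λ { (₁∼₂ {y = y}) → ⊥-elim (empty y) ; (₁∼₁ p) → p ; (₂∼₂ {y} _) → ⊥-elim (empty y) }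
      ; to-from = inj₁-drop ; from-to = λ _ → refl ; label-to = λ _ → refl }

    ∥-identityʳ : U ≃ U ∥ V
    ∥-identityʳ = record
      { to = inj₁ ; from = drop ; to-mono = inj₁
      ; from-mono = λ { (inj₁ p) → p ; (inj₂ {y} _) → ⊥-elim (empty y) }
      ; to-from = inj₁-drop ; from-to = λ _ → refl ; label-to = λ _ → refl }

-- Normal forms of series-parallel pomsets

mutual
  -- Chains are nonempty lists of primes. Hence both sides of a `par` have nodes, and the empty
  -- pomset is the only one without a normal form.
  data Prime (A : Set) : Set where
    letter : A → Prime A
    par    : Chain A → Chain A → Prime A

  data Chain (A : Set) : Set where
    [_] : Prime A → Chain A
    _∷_ : Prime A → Chain A → Chain A

infixr 5 _∷_

module _ {A : Set} where

  mutual
    ⟦_⟧ₚ : Prime A → Pomset A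
    ⟦ letter x ⟧ₚ = ⟨ x ⟩
    ⟦ par s t ⟧ₚ  = ⟦ s ⟧ ∥ ⟦ t ⟧

    ⟦_⟧ : Chain A → Pomset A
    ⟦ [ p ] ⟧ = ⟦ p ⟧ₚ
    ⟦ p ∷ s ⟧ = ⟦ p ⟧ₚ · ⟦ s ⟧

  _++_ : Chain A → Chain A → Chain A
  [ p ] ++ t   = p ∷ t
  (p ∷ s) ++ t = p ∷ (s ++ t)

  ++-· : ∀ s t → ⟦ s ++ t ⟧ ≃ ⟦ s ⟧ · ⟦ t ⟧
  ++-· [ p ] t   = ≃-refl
  ++-· (p ∷ s) t = ≃-trans (·-cong (≃-refl {U = ⟦ p ⟧ₚ}) (++-· s t)) (≃-sym (·-assoc ⟦ p ⟧ₚ ⟦ s ⟧ ⟦ t ⟧))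

  -- By induction on the construction. An empty factor of a composition is absorbed by the identity
  -- laws, so it never appears inside a chain.
  SP⇒Chain : ∀ {U : Pomset A} → SP U → (¬ Pomset.Node U) ⊎ ∃[ s ] ⟦ s ⟧ ≃ U
  SP⇒Chain one = inj₁ (λ ())
  SP⇒Chain (letter x) = inj₂ ([ letter x ] , ≃-refl)
  SP⇒Chain (seq {U} {V} u v) with SP⇒Chain u | SP⇒Chain v
  ... | inj₁ ¬u | inj₁ ¬v = inj₁ Sum.[ ¬u , ¬v ]
  ... | inj₁ ¬u | inj₂ (t , f) = inj₂ (t , ≃-trans f (·-identityˡ U V ¬u))
  ... | inj₂ (s , e) | inj₁ ¬v = inj₂ (s , ≃-trans e (·-identityʳ U V ¬v))
  ... | inj₂ (s , e) | inj₂ (t , f) = inj₂ (s ++ t , ≃-trans (++-· s t) (·-cong e f))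
  SP⇒Chain (par {U} {V} u v) with SP⇒Chain u | SP⇒Chain v
  ... | inj₁ ¬u | inj₁ ¬v = inj₁ Sum.[ ¬u , ¬v ]
  ... | inj₁ ¬u | inj₂ (t , f) = inj₂ (t , ≃-trans f (∥-identityˡ U V ¬u))
  ... | inj₂ (s , e) | inj₁ ¬v = inj₂ (s , ≃-trans e (∥-identityʳ U V ¬v))
  ... | inj₂ (s , e) | inj₂ (t , f) = inj₂ ([ par s t ] , ∥-cong e f)
  SP⇒Chain (resp-≅ e u) with SP⇒Chain u
  ... | inj₁ ¬u = inj₁ (¬u ∘ _≃_.from (≅⇒≃ e))
  ... | inj₂ (s , f) = inj₂ (s , ≃-trans f (≅⇒≃ e))

  -- Access to the last prime. Chains associate to the right, so the last prime can be split off
  -- only up to reassociation, that is, up to `_≃_`.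
  data Snoc : Chain A → Set where
    single : ∀ p → Snoc [ p ]
    snoc   : ∀ {s} t p → ⟦ s ⟧ ≃ ⟦ t ⟧ · ⟦ p ⟧ₚ → Snoc s

  snocView : ∀ s → Snoc s
  snocView [ p ] = single p
  snocView (p ∷ s) with snocView s
  ... | single q = snoc [ p ] q ≃-refl
  ... | snoc t q e =
    snoc (p ∷ t) q (≃-trans (·-cong (≃-refl {U = ⟦ p ⟧ₚ}) e) (≃-sym (·-assoc ⟦ p ⟧ₚ ⟦ t ⟧ ⟦ q ⟧ₚ)))

  -- Extremal nodes of chains

  IsMinimal IsMaximal : (U : Pomset A) → Pomset.Node U → Set
  IsMinimal U x = ∀ {y} → Pomset._≤_ U y x → y ≡ x
  IsMaximal U x = ∀ {y} → Pomset._≤_ U x y → y ≡ x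

  -- These nodes also witness that primes and chains are nonempty.
  minimalₚ : ∀ p → ∃ (IsMinimal ⟦ p ⟧ₚ)
  minimal  : ∀ s → ∃ (IsMinimal ⟦ s ⟧)
  minimalₚ (letter _) = tt , λ _ → refl
  minimalₚ (par s _)  = let x , min = minimal s in inj₁ x , λ { (inj₁ q) → cong inj₁ (min q) }
  minimal [ p ]       = minimalₚ p
  minimal (p ∷ _)     = let x , min = minimalₚ p in inj₁ x , λ { (₁∼₁ q) → cong inj₁ (min q) }

  maximalₚ : ∀ p → ∃ (IsMaximal ⟦ p ⟧ₚ)
  maximal  : ∀ s → ∃ (IsMaximal ⟦ s ⟧)
  maximalₚ (letter _) = tt , λ _ → refl
  maximalₚ (par s _)  = let x , max = maximal s in inj₁ x , λ { (inj₁ q) → cong inj₁ (max q) }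
  maximal [ p ]       = maximalₚ p
  maximal (_ ∷ s)     = let x , max = maximal s in inj₂ x , λ { (₂∼₂ q) → cong inj₂ (max q) }

  -- A parallel composition of two nonempty chains has no minimum: a candidate on one side is
  -- incomparable with every node of the other.
  min⇒letter : ∀ p {x} → Minimum (Pomset._≤_ ⟦ p ⟧ₚ) x → ∃[ l ] p ≡ letter l
  min⇒letter (letter l) _ = l , refl
  min⇒letter (par s t) {inj₁ _} min = case min (inj₂ (proj₁ (minimal t))) of λ ()
  min⇒letter (par s t) {inj₂ _} min = case min (inj₁ (proj₁ (minimal s))) of λ ()

  max⇒letter : ∀ p {x} → Maximum (Pomset._≤_ ⟦ p ⟧ₚ) x → ∃[ l ] p ≡ letter l
  max⇒letter (letter l) _ = l , refl
  max⇒letter (par s t) {inj₁ _} max = case max (inj₂ (proj₁ (minimal t))) of λ ()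
  max⇒letter (par s t) {inj₂ _} max = case max (inj₁ (proj₁ (minimal s))) of λ ()

module _ {nVar nVal : ℕ} where

  open Guards nVar nVal

  -- One-step form of the conditions

  -- A counterpart of `value` that depends on the label alone, so that labels of different pomsets
  -- can be compared.
  valueOf : Label → Var → Maybe Val
  valueOf (act _)   _ = nothing
  valueOf (state α) v = lookup α v

  IsStateLabel IsActionLabel : Label → Set
  IsStateLabel l  = ∃[ α ] l ≡ state α
  IsActionLabel l = ∃[ b ] l ≡ act b

  state≢act : ∀ {l} → IsStateLabel l → ¬ IsActionLabel l
  state≢act (_ , refl) (_ , ())

  defined⇒state : ∀ l {v n} → valueOf l v ≡ just n → IsStateLabel l
  defined⇒state (state α) _ = α , refl

  state⊎act : ∀ l → IsStateLabel l ⊎ IsActionLabel l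
  state⊎act (state α) = inj₁ (α , refl)
  state⊎act (act b)   = inj₂ (b , refl)

  -- The first clause is the content of (A5), the second that of (A6), for an action whose
  -- predecessor and successor are labelled `p` and `s`.
  Sound : Act → Label → Label → Set
  Sound (v ← val n)  p s = valueOf s v ≡ just n
  Sound (v ← var v′) p s =
    ∃[ n ] valueOf p v′ ≡ just n × valueOf s v′ ≡ just n × valueOf s v ≡ just n

  -- What a path for `v` requires of one step, without naming the assigned value: that value is
  -- already fixed by `Sound`.
  Carries : Var → Label → Label → Label → Set
  Carries v p a s = (∃[ k ] a ≡ act (v ← k)) ⊎ valueOf s v ≡ valueOf p v

  module _ (U : Pomset Label) where
    open Pomset U

    record Step (p a s : Node) : Set where
      constructor step
      field
        action  : IsActionLabel (label a)
        pred    : IsPredecessor a p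
        succ    : IsSuccessor a s
        p-state : IsStateLabel (label p)
        s-state : IsStateLabel (label s)

    record Bounded : Set where
      field
        lo hi    : Node
        lo-min   : Minimum _≤_ lo
        hi-max   : Maximum _≤_ hi
        lo-state : IsStateLabel (label lo)
        hi-state : IsStateLabel (label hi)

    Separated : Set
    Separated = ∀ s s′ → IsStateLabel (label s) → IsStateLabel (label s′) → s < s′ →
                ∃[ a ] IsActionLabel (label a) × s < a × a < s′

    -- Paths are replaced by their first (forward) or last (backward) step; since
    -- the order is well-founded in both directions, the steps can be iterated.
    record Local : Set where
      field
        bounded : Bounded
      open Bounded bounded public
      field
        separated  : Separated
        surrounded : ∀ a → IsActionLabel (label a) → ∃[ p ] ∃[ s ] Step p a s
        sound      : ∀ {p a s} x → Step p a s → label a ≡ act x → Sound x (label p) (label s)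
        forward    : ∀ u v n → valueOf (label u) v ≡ just n →
                     u ≡ hi ⊎ ∃[ a ] ∃[ s ] Step u a s × Carries v (label u) (label a) (label s)
        backward   : ∀ u v n → valueOf (label u) v ≡ just n →
                     u ≡ lo ⊎ ∃[ p ] ∃[ a ] Step p a u × Carries v (label p) (label a) (label u)

  value≡ : ∀ U s v → value U s v ≡ valueOf (Pomset.label U s) v
  value≡ U s v with Pomset.label U s
  ... | act _   = refl
  ... | state _ = refl

  -- Single steps extracted from paths

  module _ {U : Pomset Label} where
    open Pomset U
    open Po U

    pred-unique : ∀ {a p p′} → IsPredecessor a p → IsPredecessor a p′ → p ≡ p′
    pred-unique (p<a , below) (p′<a , below′) = ≤-antisym (below′ _ p<a) (below _ p′<a)

    succ-unique : ∀ {a s s′} → IsSuccessor a s → IsSuccessor a s′ → s ≡ s′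
    succ-unique (a<s , above) (a<s′ , above′) = ≤-antisym (above _ a<s′) (above′ _ a<s)

    p<s : ∀ {p a s} → Step U p a s → p < s
    p<s (step _ (p<a , _) (a<s , _) _ _) = <-trans p<a a<s

    module FromPath {v u w} (P : Path U v u w) where
      open Path P

      -- An action that assigns to a variable other than `v` meets both premises of `step-else`, so
      -- it keeps the value of `v`.
      carries : ∀ i → Carries v (label (q (inject₁ i))) (label (a i)) (label (q (suc i)))
      carries i with a-action i
      ... | v′ ← k , eq with v Fin.≟ v′
      ... | yes refl = inj₁ (k , eq)
      ... | no v≢v′  = inj₂ (trans (sym (value≡ U _ v)) (trans
            (step-else i (λ _ eq′ → other eq′) (λ _ eq′ _ → other eq′)) (value≡ U _ v)))
        where
        other : ∀ {k′} → ¬ label (a i) ≡ act (v ← k′)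
        other eq′ with refl ← trans (sym eq) eq′ = v≢v′ refl

      path-step : ∀ i → Step U (q (inject₁ i)) (a i) (q (suc i))
      path-step i = step (a-action i) (q-pred i) (q-succ i) (q-state (inject₁ i)) (q-state (suc i))

    first-step : ∀ {v u w} → Path U v u w →
                 u ≡ w ⊎ ∃[ a ] ∃[ s ] Step U u a s × Carries v (label u) (label a) (label s)
    first-step (record { n = zero ; q-first = f ; q-last = l }) = inj₁ (trans (sym f) l)
    first-step {v} P@(record { n = suc _ ; q-first = f }) =
      inj₂ (subst (λ u → ∃[ a ] ∃[ s ] Step U u a s × Carries v (label u) (label a) (label s)) f
        (_ , _ , FromPath.path-step P zero , FromPath.carries P zero))

    last-step : ∀ {v u w} → Path U v u w →
                u ≡ w ⊎ ∃[ p ] ∃[ a ] Step U p a w × Carries v (label p) (label a) (label w)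
    last-step (record { n = zero ; q-first = f ; q-last = l }) = inj₁ (trans (sym f) l)
    last-step {v} P@(record { n = suc m ; q-last = l }) =
      inj₂ (subst (λ w → ∃[ p ] ∃[ a ] Step U p a w × Carries v (label p) (label a) (label w)) l
        (_ , _ , FromPath.path-step P (fromℕ m) , FromPath.carries P (fromℕ m)))

  Conditions⇒Local : ∀ {U} → Conditions U → Local U
  Conditions⇒Local {U} c = record
    { bounded = record
      { lo = *min ; hi = *max ; lo-min = proj₁ (proj₂ A1-min) ; hi-max = proj₁ (proj₂ A1-max)
      ; lo-state = A1-min-state ; hi-state = A1-max-state }
    ; separated = A2
    ; surrounded = surrounded
    ; sound = sound
    ; forward = λ u v n eq → first-step
        (A4 u v (defined⇒state (label u) eq) (n , trans (value≡ U u v) eq))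
    ; backward = backward
    }
    where
    open Pomset U
    open Conditions c

    surrounded : ∀ a → IsActionLabel (label a) → ∃[ p ] ∃[ s ] Step U p a s
    surrounded a act-a with A3 a act-a
    ... | (p , pred , p-state) , (s , succ , s-state) =
      p , s , step act-a pred succ p-state s-state

    sound : ∀ {p a s} x → Step U p a s → label a ≡ act x → Sound x (label p) (label s)
    sound (v ← val n) (step _ _ succ _ _) eq = trans (sym (value≡ U _ v)) (A5 _ v n eq _ succ)
    sound {p} {a} {s} (v ← var v′) (step _ pred succ _ _) eq
      with (n , d) , e , f ← A6 _ v v′ eq _ _ pred succ =
        n , trans (sym (value≡ U p v′)) d
          , trans (sym (value≡ U s v′)) (trans f d)
          , trans (sym (value≡ U s v)) (trans e (trans f d))

    backward : ∀ u v n → valueOf (label u) v ≡ just n →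
               u ≡ *min ⊎ ∃[ p ] ∃[ a ] Step U p a u × Carries v (label p) (label a) (label u)
    backward u v n eq
      with A7 u v (defined⇒state (label u) eq) (n , trans (value≡ U u v) eq)
    ... | s , P , origin with last-step P
    ... | inj₂ last = inj₂ last
    ... | inj₁ refl with origin
    ... | inj₁ (s≡min , _) = inj₁ s≡min
    -- The path is empty and `u` succeeds an assignment `t` to `v`. The step around `t` ends in `u`
    -- because successors are unique, and it is the required last step.
    ... | inj₂ (t , k , eq-t , t-succ) with surrounded t (_ , eq-t)
    ... | p , s′ , st with refl ← succ-unique {U} t-succ (Step.succ st) =
      inj₂ (p , t , st , inj₁ (k , eq-t))

  -- Paths assembled from single steps

  module _ {U : Pomset Label} (loc : Local U) where
    open Pomset U
    open Po U
    open Local loc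

    private
      V : Node → Var → Maybe Val
      V = value U

    -- An assignment defines its target by soundness, and any other carrying step copies the value.
    -- So `v` stays defined and the next forward step is available.
    carries-defined : ∀ {p a s v n} → Step U p a s → Carries v (label p) (label a) (label s) →
                      valueOf (label p) v ≡ just n → ∃[ m ] valueOf (label s) v ≡ just m
    carries-defined st (inj₁ (val m , eq)) _ = m , sound _ st eq
    carries-defined st (inj₁ (var _ , eq)) _ with m , _ , _ , e ← sound _ st eq = m , e
    carries-defined st (inj₂ e) d = _ , trans e d

    nil : ∀ {u v n} → valueOf (label u) v ≡ just n → Path U v u u
    nil {u} {v} {n} d = record
      { u₁≤u₂ = ≤-refl ; n = 0 ; q = λ _ → u ; a = λ ()
      ; a-action = λ () ; u₁≤a = λ () ; a≤u₂ = λ () ; a-mono = λ ()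
      ; q-state = λ _ → defined⇒state (label u) d ; q-pred = λ () ; q-succ = λ ()
      ; q-first = refl ; q-last = refl ; v∈dom = n , trans (value≡ U u v) d
      ; step-val = λ () ; step-var = λ () ; step-else = λ () }

    cons : ∀ {u a t w v n} → Step U u a t → Carries v (label u) (label a) (label t) →
           valueOf (label u) v ≡ just n → Path U v t w → Path U v u w
    cons {u} {a₀} {v = v} st carries d
         P@(record { q = q₁ ; a = a₁ ; q-first = refl }) = record
      { u₁≤u₂ = ≤-trans (proj₁ (p<s st)) P.u₁≤u₂
      ; n = suc P.n
      ; q = q
      ; a = a
      ; a-action = λ { zero → action ; (suc i) → P.a-action i }
      ; u₁≤a = λ { zero → proj₁ (proj₁ pred) ; (suc i) → ≤-trans (proj₁ (p<s st)) (P.u₁≤a i) }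
      ; a≤u₂ = λ { zero → ≤-trans (proj₁ (proj₁ succ)) P.u₁≤u₂ ; (suc i) → P.a≤u₂ i }
      ; a-mono = λ
        { zero (suc j) _ → ≤-trans (proj₁ (proj₁ succ)) (P.u₁≤a j)
        ; (suc i) (suc j) e → P.a-mono i j (suc-injective e) }
      ; q-state = λ { zero → p-state ; (suc i) → P.q-state i }
      ; q-pred = λ { zero → pred ; (suc i) → P.q-pred i }
      ; q-succ = λ { zero → succ ; (suc i) → P.q-succ i }
      ; q-first = refl
      ; q-last = P.q-last
      ; v∈dom = _ , trans (value≡ U u v) d
      ; step-val = λ
        { zero m e → trans (value≡ U _ v) (sound _ st e)
        ; (suc i) → P.step-val i }
      ; step-var = λ
        { zero v′ e _ → let n , p-v′ , _ , s-v = sound _ st e in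
            trans (value≡ U _ v) (trans s-v (sym (trans (value≡ U u v′) p-v′)))
        ; (suc i) → P.step-var i }
      ; step-else = λ
        { zero ≢val ≢var → keep ≢val ≢var carries
        ; (suc i) → P.step-else i }
      }
      where
      module P = Path P
      open Step st
      q : Fin (suc (suc P.n)) → Node
      q zero    = u
      q (suc i) = q₁ i
      a : Fin (suc P.n) → Node
      a zero    = a₀
      a (suc i) = a₁ i
      -- The two premises exclude every assignment to `v`: for `v ← var v′`, soundness makes `v′`
      -- defined at `u`. Only the value-keeping alternative of `Carries` survives.
      keep : (∀ m → label a₀ ≢ act (v ← val m)) →
             (∀ v′ → label a₀ ≡ act (v ← var v′) → ¬ (∃[ n ] V u v′ ≡ just n)) →
             Carries v (label u) (label a₀) (label (q₁ zero)) → V (q₁ zero) v ≡ V u v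
      keep ≢val ≢var (inj₁ (val m , e)) = contradiction e (≢val m)
      keep ≢val ≢var (inj₁ (var v′ , e)) =
        let n , p-v′ , _ = sound _ st e in
        contradiction (n , trans (value≡ U u v′) p-v′) (≢var v′ e)
      keep ≢val ≢var (inj₂ e) = trans (value≡ U _ v) (trans e (sym (value≡ U u v)))

    -- Forward steps are strictly increasing, so following them ends, and it can end only at the
    -- upper bound.
    path-to-hi : ∀ u {v n} → Acc (flip _<_) u → valueOf (label u) v ≡ just n → Path U v u hi
    path-to-hi u (acc rs) d with forward u _ _ d
    ... | inj₁ refl = nil d
    ... | inj₂ (a , s , st , carries) =
      cons st carries d (path-to-hi s (rs (p<s st)) (proj₂ (carries-defined st carries d)))

    Origin : Var → Node → Set
    Origin v s = (s ≡ lo × ∃[ n ] V s v ≡ just n) ⊎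
                 (∃[ t ] ∃[ k ] label t ≡ act (v ← k) × IsSuccessor t s)

    -- The accumulated path `P` is extended at its start by backward steps that keep `v`. The search
    -- stops at the lower bound or at the first assignment to `v`; that assignment is not prepended,
    -- since its successor is the origin asked for in (A7).
    path-from-origin : ∀ {u v n w} → Acc _<_ u → valueOf (label u) v ≡ just n → Path U v u w →
                       ∃[ s ] Path U v s w × Origin v s
    path-from-origin {u} {v} (acc rs) d P with backward u _ _ d
    ... | inj₁ refl = u , P , inj₁ (refl , _ , trans (value≡ U u v) d)
    ... | inj₂ (p , a , st , inj₁ (k , e)) = u , P , inj₂ (a , k , e , Step.succ st)
    ... | inj₂ (p , a , st , inj₂ e) =
      path-from-origin (rs (p<s st)) (trans (sym e) d) (cons st (inj₂ e) (trans (sym e) d) P)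

    Local⇒Conditions : Conditions U
    Local⇒Conditions = record
      { A1-min = lo , lo-min , λ {y} min → ≤-antisym (lo-min y) (min lo)
      ; A1-max = hi , hi-max , λ {y} max → ≤-antisym (max hi) (hi-max y)
      ; A1-min-state = lo-state
      ; A1-max-state = hi-state
      ; A2 = separated
      ; A3 = λ a act-a → let p , s , st = surrounded a act-a in
               (p , Step.pred st , Step.p-state st) , (s , Step.succ st , Step.s-state st)
      ; A4 = λ u v _ (n , d) → path-to-hi u (>-wellFounded u) (trans (sym (value≡ U u v)) d)
      ; A5 = A5
      ; A6 = A6
      ; A7 = λ u v _ (n , d) → let d′ = trans (sym (value≡ U u v)) d in
               path-from-origin (<-wellFounded u) d′ (nil d′)
      }
      where
      A5 : ∀ u v n → label u ≡ act (v ← val n) → ∀ s → IsSuccessor u s → V s v ≡ just n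
      A5 u v n e s succ with surrounded u (_ , e)
      ... | _ , _ , st with refl ← succ-unique {U} succ (Step.succ st) =
        trans (value≡ U s v) (sound _ st e)

      A6 : ∀ u v v′ → label u ≡ act (v ← var v′) →
           ∀ p s → IsPredecessor u p → IsSuccessor u s →
           (∃[ n ] V p v′ ≡ just n) × V s v ≡ V s v′ × V s v′ ≡ V p v′
      A6 u v v′ e p s pred succ with surrounded u (_ , e)
      ... | p′ , s′ , st
        with refl ← pred-unique {U} pred (Step.pred st)
           | refl ← succ-unique {U} succ (Step.succ st)
        with n , p-v′ , s-v′ , s-v ← sound _ st e =
          (n , trans (value≡ U p v′) p-v′)
          , trans (trans (value≡ U s v) s-v) (sym (trans (value≡ U s v′) s-v′))
          , trans (trans (value≡ U s v′) s-v′) (sym (trans (value≡ U p v′) p-v′))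

  -- Embeddings

  -- Extension of partial functions on states, equality on actions. Strict extensions arise at the
  -- end states of a parallel composition, where each side knows only part of the variables.
  data _⊑_ : Label → Label → Set where
    act   : ∀ {b} → act b ⊑ act b
    state : ∀ {α β} → (∀ v {n} → lookup α v ≡ just n → lookup β v ≡ just n) → state α ⊑ state β

  ⊑-reflexive : ∀ {l l′} → l ≡ l′ → l ⊑ l′
  ⊑-reflexive {act _}   refl = act
  ⊑-reflexive {state _} refl = state λ _ e → e

  ⊑-value : ∀ {l l′ v n} → l ⊑ l′ → valueOf l v ≡ just n → valueOf l′ v ≡ just n
  ⊑-value (state α⊑β) d = α⊑β _ d

  ⊑-act : ∀ {l l′ b} → l ⊑ l′ → l ≡ act b → l′ ≡ act b
  ⊑-act act e = e

  ⊑-act⁻ : ∀ {l l′ b} → l ⊑ l′ → l′ ≡ act b → l ≡ act b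
  ⊑-act⁻ act e = e

  ⊑-state : ∀ {l l′} → l ⊑ l′ → IsStateLabel l → IsStateLabel l′
  ⊑-state (state _) _ = _ , refl

  ⊑-state⁻ : ∀ {l l′} → l ⊑ l′ → IsStateLabel l′ → IsStateLabel l
  ⊑-state⁻ (state _) _ = _ , refl

  -- `Sound` speaks only of defined values, so it survives extension. `Carries` does not in general,
  -- as it may equate two undefined values.
  ⊑-sound : ∀ {p p′ s s′} x → p ⊑ p′ → s ⊑ s′ → Sound x p s → Sound x p′ s′
  ⊑-sound (v ← val m) p⊑ s⊑ e = ⊑-value s⊑ e
  ⊑-sound (v ← var v′) p⊑ s⊑ (m , d , e , f) = m , ⊑-value p⊑ d , ⊑-value s⊑ e , ⊑-value s⊑ f

  -- The last two fields make the predecessor and the successor of an action-node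
  -- of X the same in W.
  record Embedding (X W : Pomset Label) : Set where
    private
      module X = Pomset X
      module W = Pomset W
    field
      f      : X.Node → W.Node
      mono   : ∀ {x y} → x X.≤ y → f x W.≤ f y
      cancel : ∀ {x y} → f x W.≤ f y → x X.≤ y
      labels : ∀ x → X.label x ⊑ W.label (f x)
      below  : ∀ {a t} → IsActionLabel (X.label a) → t W.< f a → ∃[ x ] t W.≤ f x × x X.< a
      above  : ∀ {a t} → IsActionLabel (X.label a) → f a W.< t → ∃[ x ] f x W.≤ t × a X.< x

  module _ {X W : Pomset Label} (e : Embedding X W) where
    private
      module X = Pomset X
      module W = Pomset W
      module XO = Po X
      module WO = Po W
    open Embedding e

    embed-< : ∀ {x y} → x X.< y → f x W.< f y
    embed-< (x≤y , x≢y) = mono x≤y , λ eq →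
      x≢y (XO.≤-antisym x≤y (cancel (WO.≤-reflexive (sym eq))))

    reflect-< : ∀ {x y} → f x W.< f y → x X.< y
    reflect-< (x≤y , x≢y) = cancel x≤y , λ { refl → x≢y refl }

    embed-act : ∀ {a} → IsActionLabel (X.label a) → IsActionLabel (W.label (f a))
    embed-act {a} (b , eq) = b , ⊑-act (labels a) eq

    reflect-act : ∀ {a} → IsActionLabel (W.label (f a)) → IsActionLabel (X.label a)
    reflect-act {a} (b , eq) = b , ⊑-act⁻ (labels a) eq

    -- A node of `W` below `f a` need not be an image, but by `below` it is bounded by the image of
    -- a node below `a`, and hence by `f p`; dually for `s`.
    embed-step : ∀ {p a s} → Step X p a s → Step W (f p) (f a) (f s)
    embed-step {p} {a} {s} (step action (p<a , p-max) (a<s , s-min) p-state s-state) = step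
      (embed-act action)
      (embed-< p<a , λ t t<a → let x , t≤x , x<a = below action t<a in WO.≤-trans t≤x (mono (p-max x x<a)))
      (embed-< a<s , λ t a<t → let x , x≤t , a<x = above action a<t in WO.≤-trans (mono (s-min x a<x)) x≤t)
      (⊑-state (labels p) p-state)
      (⊑-state (labels s) s-state)

    reflect-step : ∀ {p a s} → Step W (f p) (f a) (f s) → Step X p a s
    reflect-step {p} {a} {s} (step action (p<a , p-max) (a<s , s-min) p-state s-state) = step
      (reflect-act action)
      (reflect-< p<a , λ x x<a → cancel (p-max (f x) (embed-< x<a)))
      (reflect-< a<s , λ x a<x → cancel (s-min (f x) (embed-< a<x)))
      (⊑-state⁻ (labels p) p-state)
      (⊑-state⁻ (labels s) s-state)

    -- `below` yields an image node between `p` and `f a`. As `p` is the predecessor, that node is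
    -- `p` itself; dually for `s`.
    reflect-step-nodes : ∀ {p a s} → Step W p (f a) s → ∃[ p′ ] ∃[ s′ ] f p′ ≡ p × f s′ ≡ s × Step X p′ a s′
    reflect-step-nodes st@(step action (p<a , p-max) (a<s , s-min) _ _)
      with below (reflect-act action) p<a | above (reflect-act action) a<s
    ... | p′ , p≤p′ , p′<a | s′ , s′≤s , a<s′
      with refl ← WO.≤-antisym (p-max _ (embed-< p′<a)) p≤p′
         | refl ← WO.≤-antisym s′≤s (s-min _ (embed-< a<s′)) = p′ , s′ , refl , refl , reflect-step st

  -- Gluing the conditions from embedded pieces

  module _ {I : Set} (X : I → Pomset Label) {W : Pomset Label}
           (e : ∀ i → Embedding (X i) W) (loc : ∀ i → Local (X i)) (bounded : Bounded W) where
    private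
      module X i = Pomset (X i)
      module W = Pomset W
      module WO = Po W
      module E i = Embedding (e i)
      module L i = Local (loc i)
      open Bounded bounded

    -- Each condition is checked in a piece that covers the nodes concerned. For the forward
    -- condition the chosen piece must not end at the node, unless `W` ends there too, since
    -- otherwise the piece offers no step to embed; dually for the backward condition.
    glue :
      (∀ {s s′} → IsStateLabel (W.label s) → IsStateLabel (W.label s′) → s W.< s′ →
        ∃[ i ] ∃[ x ] ∃[ y ] s W.≤ E.f i x × E.f i y W.≤ s′ × X._<_ i x y ×
          IsStateLabel (X.label i x) × IsStateLabel (X.label i y)) →
      (∀ {a} → IsActionLabel (W.label a) → ∃[ i ] ∃[ x ] E.f i x ≡ a) →
      (∀ {u v n} → valueOf (W.label u) v ≡ just n →
        ∃[ i ] ∃[ x ] E.f i x ≡ u × valueOf (X.label i x) v ≡ just n × (x ≡ L.hi i → u ≡ hi)) →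
      (∀ {u v n} → valueOf (W.label u) v ≡ just n →
        ∃[ i ] ∃[ x ] E.f i x ≡ u × valueOf (X.label i x) v ≡ just n × (x ≡ L.lo i → u ≡ lo)) →
      Local W
    glue cover-< cover-act cover-hi cover-lo = record
      { bounded = bounded ; separated = separated ; surrounded = surrounded ; sound = sound
      ; forward = forward ; backward = backward }
      where
      separated : Separated W
      separated s s′ st-s st-s′ s<s′ with cover-< st-s st-s′ s<s′
      ... | i , x , y , s≤x , y≤s′ , x<y , st-x , st-y with L.separated i x y st-x st-y x<y
      ... | a , act-a , x<a , a<y =
        E.f i a , embed-act (e i) act-a ,
        WO.≤-<-trans s≤x (embed-< (e i) x<a) , WO.<-≤-trans (embed-< (e i) a<y) y≤s′

      surrounded : ∀ a → IsActionLabel (W.label a) → ∃[ p ] ∃[ s ] Step W p a s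
      surrounded a act-a with cover-act act-a
      ... | i , x , refl with L.surrounded i x (reflect-act (e i) act-a)
      ... | p , s , st = _ , _ , embed-step (e i) st

      sound : ∀ {p a s} x → Step W p a s → W.label a ≡ act x → Sound x (W.label p) (W.label s)
      sound x st eq with cover-act (_ , eq)
      ... | i , a , refl with reflect-step-nodes (e i) st
      ... | p , s , refl , refl , st′ =
        ⊑-sound x (E.labels i p) (E.labels i s) (L.sound i x st′ (⊑-act⁻ (E.labels i a) eq))

      forward : ∀ u v n → valueOf (W.label u) v ≡ just n →
                u ≡ hi ⊎ ∃[ a ] ∃[ s ] Step W u a s × Carries v (W.label u) (W.label a) (W.label s)
      forward u v n d with cover-hi d
      ... | i , x , refl , d′ , hi⇒hi with L.forward i x v n d′
      ... | inj₁ x≡hi = inj₁ (hi⇒hi x≡hi)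
      ... | inj₂ (a , s , st , inj₁ (k , eq)) =
        inj₂ (_ , _ , embed-step (e i) st , inj₁ (k , ⊑-act (E.labels i a) eq))
      -- In the piece both values equal `just n`, and extension preserves defined values.
      ... | inj₂ (a , s , st , inj₂ eq) =
        inj₂ (_ , _ , embed-step (e i) st , inj₂ (trans (⊑-value (E.labels i s) (trans eq d′)) (sym d)))

      backward : ∀ u v n → valueOf (W.label u) v ≡ just n →
                 u ≡ lo ⊎ ∃[ p ] ∃[ a ] Step W p a u × Carries v (W.label p) (W.label a) (W.label u)
      backward u v n d with cover-lo d
      ... | i , x , refl , d′ , lo⇒lo with L.backward i x v n d′
      ... | inj₁ x≡lo = inj₁ (lo⇒lo x≡lo)
      ... | inj₂ (p , a , st , inj₁ (k , eq)) =
        inj₂ (_ , _ , embed-step (e i) st , inj₁ (k , ⊑-act (E.labels i a) eq))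
      ... | inj₂ (p , a , st , inj₂ eq) =
        inj₂ (_ , _ , embed-step (e i) st ,
          inj₂ (trans d (sym (⊑-value (E.labels i p) (trans (sym eq) d′)))))

  -- Restricting the conditions to an embedded piece

  module _ {X W : Pomset Label} (e : Embedding X W) (loc : Local W)
           (bounded : Bounded X) (separated : Separated X) where
    private
      module X = Pomset X
      module W = Pomset W
      module L = Local loc
      open Embedding e
      open Bounded bounded

    -- States of `X` may be smaller than their images. The first two premises say that nothing is
    -- lost that a step inside `X` delivers to its successor or takes over unchanged from its
    -- predecessor; the last two supply, for each value kept in `X`, a neighbouring step whose
    -- action lies in `X`.
    restrict :
      (∀ {p a s v n} → Step X p a s → Carries v (W.label (f p)) (W.label (f a)) (W.label (f s)) →
        valueOf (W.label (f s)) v ≡ just n → valueOf (X.label s) v ≡ just n) →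
      (∀ {p a s v n} → Step X p a s → valueOf (W.label (f s)) v ≡ valueOf (W.label (f p)) v →
        valueOf (W.label (f p)) v ≡ just n → valueOf (X.label p) v ≡ just n) →
      (∀ {u v n} → valueOf (X.label u) v ≡ just n →
        u ≡ hi ⊎ ∃[ a ] ∃[ s ] Step W (f u) (f a) s ×
          Carries v (W.label (f u)) (W.label (f a)) (W.label s)) →
      (∀ {u v n} → valueOf (X.label u) v ≡ just n →
        u ≡ lo ⊎ ∃[ p ] ∃[ a ] Step W p (f a) (f u) ×
          Carries v (W.label p) (W.label (f a)) (W.label (f u))) →
      Local X
    restrict written read next previous = record
      { bounded = bounded ; separated = separated ; surrounded = surrounded ; sound = sound
      ; forward = forward ; backward = backward }
      where
      surrounded : ∀ a → IsActionLabel (X.label a) → ∃[ p ] ∃[ s ] Step X p a s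
      surrounded a act-a with L.surrounded (f a) (embed-act e act-a)
      ... | _ , _ , st with reflect-step-nodes e st
      ... | p , s , _ , _ , st′ = p , s , st′

      sound : ∀ {p a s} x → Step X p a s → X.label a ≡ act x → Sound x (X.label p) (X.label s)
      sound {a = a} (v ← val m) st eq =
        written st (inj₁ (_ , eq′)) (L.sound _ (embed-step e st) eq′)
        where eq′ = ⊑-act (labels a) eq
      sound {a = a} (v ← var v′) st eq
        with m , d , d′ , d″ ← L.sound _ (embed-step e st) (⊑-act (labels a) eq) =
        -- By soundness the source `v′` has the same value before and after, so the step also
        -- carries `v′` and both retention premises apply to it.
        let same = trans d′ (sym d) in
        m , read st same d , written st (inj₂ same) d′ , written st (inj₁ (_ , ⊑-act (labels a) eq)) d″

      forward : ∀ u v n → valueOf (X.label u) v ≡ just n →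
                u ≡ hi ⊎ ∃[ a ] ∃[ s ] Step X u a s × Carries v (X.label u) (X.label a) (X.label s)
      forward u v n d with next d
      ... | inj₁ u≡hi = inj₁ u≡hi
      ... | inj₂ (a , s , st , carries) with reflect-step-nodes e st
      ... | _ , s′ , _ , refl , _ with carries
      ... | inj₁ (k , eq) = inj₂ (a , s′ , reflect-step e st , inj₁ (k , ⊑-act⁻ (labels a) eq))
      ... | inj₂ eq = inj₂ (a , s′ , reflect-step e st , inj₂
        (trans (written (reflect-step e st) (inj₂ eq) (trans eq (⊑-value (labels u) d))) (sym d)))

      backward : ∀ u v n → valueOf (X.label u) v ≡ just n →
                 u ≡ lo ⊎ ∃[ p ] ∃[ a ] Step X p a u × Carries v (X.label p) (X.label a) (X.label u)
      backward u v n d with previous d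
      ... | inj₁ u≡lo = inj₁ u≡lo
      ... | inj₂ (p , a , st , carries) with reflect-step-nodes e st
      ... | p′ , s , refl , _ , _ with carries
      ... | inj₁ (k , eq) = inj₂ (p′ , a , reflect-step e st , inj₁ (k , ⊑-act⁻ (labels a) eq))
      ... | inj₂ eq = inj₂ (p′ , a , reflect-step e st , inj₂
        (trans d (sym (read (reflect-step e st) eq (trans (sym eq) (⊑-value (labels u) d))))))

  -- Invariance under isomorphism

  ≃-embedding : ∀ {U V} → U ≃ V → Embedding U V
  ≃-embedding {U} {V} e = record
    { f = to ; mono = to-mono ; cancel = cancel ; labels = λ x → ⊑-reflexive (sym (label-to x))
    ; below = λ {_} {t} _ (t≤a , t≢a) →
        from t , ≤-reflexive (sym (to-from t)) ,
        cancel (subst (λ z → z V.≤ _) (sym (to-from t)) t≤a) , λ { refl → t≢a (sym (to-from t)) }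
    ; above = λ {_} {t} _ (a≤t , a≢t) →
        from t , ≤-reflexive (to-from t) ,
        cancel (subst (V._≤_ _) (sym (to-from t)) a≤t) , λ { refl → a≢t (to-from t) } }
    where
    open _≃_ e
    open Po V
    module U = Pomset U
    module V = Pomset V
    cancel : ∀ {x y} → to x V.≤ to y → x U.≤ y
    cancel {x} {y} p = subst (λ z → z U.≤ y) (from-to x) (subst (U._≤_ _) (from-to y) (from-mono p))

  -- Gluing with a single piece, indexed by `⊤`.
  Local-resp-≃ : ∀ {U V} → U ≃ V → Local U → Local V
  Local-resp-≃ {U} {V} e loc = glue {⊤} (λ _ → U) (λ _ → emb) (λ _ → loc)
    (record { lo = to lo ; hi = to hi
            ; lo-min = λ y → subst (V._≤_ _) (to-from y) (to-mono (lo-min (from y)))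
            ; hi-max = λ y → subst (λ z → z V.≤ _) (to-from y) (to-mono (hi-max (from y)))
            ; lo-state = ⊑-state (labels lo) lo-state ; hi-state = ⊑-state (labels hi) hi-state })
    (λ {s} {s′} → cover-< {s} {s′})
    (λ {a} _ → tt , from a , to-from a)
    (λ {u} {v} {n} d → tt , from u , to-from u ,
      subst (λ l → valueOf l v ≡ just n) (label-from u) d , λ eq → trans (sym (to-from u)) (cong to eq))
    (λ {u} {v} {n} d → tt , from u , to-from u ,
      subst (λ l → valueOf l v ≡ just n) (label-from u) d , λ eq → trans (sym (to-from u)) (cong to eq))
    where
    emb = ≃-embedding e
    open _≃_ e
    open Embedding emb using (labels)
    open Local loc
    module V = Pomset V
    label-from : ∀ y → V.label y ≡ Pomset.label U (from y)
    label-from y = trans (cong V.label (sym (to-from y))) (label-to (from y))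
    cover-< : ∀ {s s′} → IsStateLabel (V.label s) → IsStateLabel (V.label s′) → s V.< s′ → _
    cover-< {s} {s′} st-s st-s′ s<s′ =
      tt , from s , from s′ , Po.≤-reflexive V (sym (to-from s)) , Po.≤-reflexive V (to-from s′) ,
      reflect-< emb (subst (V._< _) (sym (to-from s)) (subst (s V.<_) (sym (to-from s′)) s<s′)) ,
      subst IsStateLabel (label-from s) st-s , subst IsStateLabel (label-from s′) st-s′

  -- Sequential composition at a state

  module _ (U V : Pomset Label) (γ : State) where
    private
      module U = Pomset U
      module V = Pomset V
      module L = Pomset (U · ⟪ γ ⟫)
      module R = Pomset (⟪ γ ⟫ · V)
      W = U · ⟪ γ ⟫ · V
      module W = Pomset W
      module WO = Po W

    cut : W.Node
    cut = inj₂ (inj₁ tt)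

    left : L.Node → W.Node
    left (inj₁ u) = inj₁ u
    left (inj₂ _) = cut

    cut≤right : ∀ y → cut W.≤ inj₂ y
    cut≤right (inj₁ _) = ₂∼₂ (₁∼₁ refl)
    cut≤right (inj₂ _) = ₂∼₂ ₁∼₂

    left≤cut : ∀ x → left x W.≤ cut
    left≤cut (inj₁ _) = ₁∼₂
    left≤cut (inj₂ _) = ₂∼₂ (₁∼₁ refl)

    left-≤ : ∀ x {y} → y W.≤ left x → ∃[ x′ ] left x′ ≡ y
    left-≤ (inj₁ _) {inj₁ y} _ = inj₁ y , refl
    left-≤ (inj₂ _) {inj₁ y} _ = inj₁ y , refl
    left-≤ (inj₂ _) {inj₂ _} (₂∼₂ (₁∼₁ _)) = inj₂ tt , refl

    left-embedding : Embedding (U · ⟪ γ ⟫) W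
    left-embedding = record
      { f = left
      ; mono = λ { ₁∼₂ → ₁∼₂ ; (₁∼₁ p) → ₁∼₁ p ; (₂∼₂ _) → ₂∼₂ (₁∼₁ refl) }
      ; cancel = λ { {inj₁ _} {inj₁ _} (₁∼₁ p) → ₁∼₁ p ; {inj₁ _} {inj₂ _} _ → ₁∼₂
                   ; {inj₂ _} {inj₁ _} () ; {inj₂ _} {inj₂ _} _ → ₂∼₂ refl }
      ; labels = λ { (inj₁ _) → ⊑-reflexive refl ; (inj₂ _) → ⊑-reflexive refl }
      ; below = λ
        { {inj₁ _} {inj₁ t} _ (₁∼₁ p , ≢) → inj₁ t , WO.≤-refl , ₁∼₁ p , λ { refl → ≢ refl }
        ; {inj₂ _} (_ , ()) }
      ; above = λ
        { {inj₁ _} {inj₁ t} _ (₁∼₁ p , ≢) → inj₁ t , WO.≤-refl , ₁∼₁ p , λ { refl → ≢ refl }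
        -- Everything outside the left part lies above the cut, which is the image of a node of the
        -- left part.
        ; {inj₁ _} {inj₂ y} _ _ → inj₂ tt , cut≤right y , ₁∼₂ , λ ()
        ; {inj₂ _} (_ , ()) } }

    right-embedding : Embedding (⟪ γ ⟫ · V) W
    right-embedding = record
      { f = inj₂
      ; mono = ₂∼₂
      ; cancel = λ { (₂∼₂ p) → p }
      ; labels = λ _ → ⊑-reflexive refl
      ; below = λ
        { {inj₁ _} (_ , ())
        ; {inj₂ _} {inj₁ _} _ _ → inj₁ tt , ₁∼₂ , ₁∼₂ , λ ()
        ; {inj₂ _} {inj₂ t} _ (₂∼₂ p , ≢) → t , WO.≤-refl , p , λ { refl → ≢ refl } }
      ; above = λ { {t = inj₂ t} _ (₂∼₂ p , ≢) → t , WO.≤-refl , p , λ { refl → ≢ refl } } }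

    -- The two pieces overlap in the cut. A variable of the cut is followed forwards in the right
    -- piece and backwards in the left one, where the cut is not the end of the piece in the
    -- direction concerned.
    Local-· : Local (U · ⟪ γ ⟫) → Local (⟪ γ ⟫ · V) → Local W
    Local-· locL locR = glue X emb loc
      (record
        { lo = left LL.lo ; hi = inj₂ LR.hi
        ; lo-min = λ { (inj₁ u) → Embedding.mono left-embedding (LL.lo-min (inj₁ u))
                     ; (inj₂ y) → WO.≤-trans (left≤cut LL.lo) (cut≤right y) }
        ; hi-max = λ { (inj₁ u) → ₁∼₂ ; (inj₂ y) → ₂∼₂ (LR.hi-max y) }
        ; lo-state = ⊑-state (Embedding.labels left-embedding LL.lo) LL.lo-state
        ; hi-state = LR.hi-state })
      (λ { {inj₁ u} {inj₁ u′} st st′ (₁∼₁ p , ≢) →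
             true , inj₁ u , inj₁ u′ , WO.≤-refl , WO.≤-refl , (₁∼₁ p , λ { refl → ≢ refl }) , st , st′
         ; {inj₁ u} {inj₂ y} st _ _ →
             true , inj₁ u , inj₂ tt , WO.≤-refl , cut≤right y , (₁∼₂ , λ ()) , st , γ , refl
         ; {inj₂ y} {inj₂ y′} st st′ (₂∼₂ p , ≢) →
             false , y , y′ , WO.≤-refl , WO.≤-refl , (p , λ { refl → ≢ refl }) , st , st′ })
      (λ { {inj₁ u} _ → true , inj₁ u , refl ; {inj₂ y} _ → false , y , refl })
      (λ { {inj₁ u} d → true , inj₁ u , refl , d , λ eq → case subst (L._≤_ _) (sym eq) (LL.hi-max (inj₂ tt)) of λ ()
         ; {inj₂ y} d → false , y , refl , d , cong inj₂ })
      (λ { {inj₁ u} d → true , inj₁ u , refl , d , cong left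
         ; {inj₂ (inj₁ _)} d → true , inj₂ tt , refl , d , cong left
         ; {inj₂ (inj₂ y)} d → false , inj₂ y , refl , d , λ eq →
             case subst (λ z → z R.≤ inj₁ tt) (sym eq) (LR.lo-min (inj₁ tt)) of λ () })
      where
      module LL = Local locL
      module LR = Local locR
      X : Bool → Pomset Label
      X true  = U · ⟪ γ ⟫
      X false = ⟪ γ ⟫ · V
      emb : ∀ i → Embedding (X i) W
      emb true  = left-embedding
      emb false = right-embedding
      loc : ∀ i → Local (X i)
      loc true  = locL
      loc false = locR

    -- Cutting a sequential composition at a state

    module _ (locW : Local W) where
      private
        module LW = Local locW

      Local-·ˡ : Local (U · ⟪ γ ⟫)
      Local-·ˡ = restrict left-embedding locW bounded
        separated
        (λ { {s = inj₁ _} _ _ d → d ; {s = inj₂ _} _ _ d → d })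
        (λ { {p = inj₁ _} _ _ d → d ; {p = inj₂ _} _ _ d → d })
        (λ {u} → next {u})
        (λ {u} → previous {u})
        where
        lo′ : ∃[ x ] left x ≡ LW.lo
        lo′ = left-≤ (inj₂ tt) (LW.lo-min cut)
        bounded : Bounded (U · ⟪ γ ⟫)
        bounded = record
          { lo = proj₁ lo′ ; hi = inj₂ tt
          ; lo-min = λ x → Embedding.cancel left-embedding
              (subst (W._≤ left x) (sym (proj₂ lo′)) (LW.lo-min (left x)))
          ; hi-max = λ { (inj₁ _) → ₁∼₂ ; (inj₂ _) → ₂∼₂ refl }
          ; lo-state = ⊑-state⁻ (Embedding.labels left-embedding (proj₁ lo′))
              (subst (λ z → IsStateLabel (W.label z)) (sym (proj₂ lo′)) LW.lo-state)
          ; hi-state = γ , refl }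
        separated : Separated (U · ⟪ γ ⟫)
        separated s s′ st st′ s<s′
          with LW.separated (left s) (left s′) (⊑-state (Embedding.labels left-embedding s) st)
                 (⊑-state (Embedding.labels left-embedding s′) st′) (embed-< left-embedding s<s′)
        ... | a , act-a , s<a , a<s′ with left-≤ s′ (proj₁ a<s′)
        ... | a , refl = a , reflect-act left-embedding {a} act-a ,
          reflect-< left-embedding s<a , reflect-< left-embedding a<s′
        next : ∀ {u v n} → valueOf (L.label u) v ≡ just n →
          u ≡ inj₂ tt ⊎ ∃[ a ] ∃[ s ] Step W (left u) (left a) s ×
            Carries v (W.label (left u)) (W.label (left a)) (W.label s)
        next {inj₂ tt} d = inj₁ refl
        next {inj₁ u} {v} d with LW.forward (inj₁ u) v _ d
        ... | inj₁ eq = case subst (cut W.≤_) (sym eq) (LW.hi-max cut) of λ ()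
        ... | inj₂ (inj₁ a , s , st , carries) = inj₂ (inj₁ a , s , st , carries)
        ... | inj₂ (inj₂ (inj₁ _) , _ , st , _) = case Step.action st of λ ()
        -- A node of `U` is not the predecessor of an action in `V`, because the cut lies strictly
        -- between them.
        ... | inj₂ (inj₂ (inj₂ _) , _ , st , _) =
          case proj₂ (Step.pred st) cut (₂∼₂ ₁∼₂ , λ ()) of λ ()
        previous : ∀ {u v n} → valueOf (L.label u) v ≡ just n →
          u ≡ proj₁ lo′ ⊎ ∃[ p ] ∃[ a ] Step W p (left a) (left u) ×
            Carries v (W.label p) (W.label (left a)) (W.label (left u))
        previous {u} {v} d
          with LW.backward (left u) v _ (⊑-value (Embedding.labels left-embedding u) d)
        ... | inj₁ eq = inj₁ (Po.≤-antisym (U · ⟪ γ ⟫)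
          (Embedding.cancel left-embedding (WO.≤-reflexive (trans eq (sym (proj₂ lo′)))))
          (Bounded.lo-min bounded u))
        ... | inj₂ (p , a , st , carries) with left-≤ u (proj₁ (proj₁ (Step.succ st)))
        ... | a , refl = inj₂ (p , a , st , carries)

      right-≥ : ∀ {y z} → inj₂ y W.≤ z → ∃[ y′ ] inj₂ y′ ≡ z
      right-≥ (₂∼₂ {y = y′} _) = y′ , refl

      Local-·ʳ : Local (⟪ γ ⟫ · V)
      Local-·ʳ = restrict right-embedding locW bounded separated
        (λ _ _ d → d) (λ _ _ d → d) (λ {u} → next {u}) (λ {u} → previous {u})
        where
        hi′ : ∃[ y ] inj₂ y ≡ LW.hi
        hi′ = right-≥ (LW.hi-max cut)
        bounded : Bounded (⟪ γ ⟫ · V)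
        bounded = record
          { lo = inj₁ tt ; hi = proj₁ hi′
          ; lo-min = λ { (inj₁ _) → ₁∼₁ refl ; (inj₂ _) → ₁∼₂ }
          ; hi-max = λ y → Embedding.cancel right-embedding
              (subst (inj₂ y W.≤_) (sym (proj₂ hi′)) (LW.hi-max (inj₂ y)))
          ; lo-state = γ , refl
          ; hi-state = subst (λ z → IsStateLabel (W.label z)) (sym (proj₂ hi′)) LW.hi-state }
        separated : Separated (⟪ γ ⟫ · V)
        separated s s′ st st′ s<s′
          with LW.separated (inj₂ s) (inj₂ s′) st st′ (embed-< right-embedding s<s′)
        ... | a , act-a , s<a , a<s′ with right-≥ (proj₁ s<a)
        ... | a , refl = a , act-a , reflect-< right-embedding s<a , reflect-< right-embedding a<s′
        next : ∀ {u v n} → valueOf (R.label u) v ≡ just n →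
          u ≡ proj₁ hi′ ⊎ ∃[ a ] ∃[ s ] Step W (inj₂ u) (inj₂ a) s ×
            Carries v (R.label u) (R.label a) (W.label s)
        next {u} {v} d with LW.forward (inj₂ u) v _ d
        ... | inj₁ eq = inj₁ (inj₂-injective (trans eq (sym (proj₂ hi′))))
        ... | inj₂ (a , s , st , carries) with right-≥ (proj₁ (proj₁ (Step.pred st)))
        ... | a , refl = inj₂ (a , s , st , carries)
        previous : ∀ {u v n} → valueOf (R.label u) v ≡ just n →
          u ≡ inj₁ tt ⊎ ∃[ p ] ∃[ a ] Step W p (inj₂ a) (inj₂ u) ×
            Carries v (W.label p) (R.label a) (R.label u)
        previous {inj₁ tt} d = inj₁ refl
        previous {inj₂ u} {v} d with LW.backward (inj₂ (inj₂ u)) v _ d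
        ... | inj₁ eq = case subst (W._≤ cut) (sym eq) (LW.lo-min cut) of λ { (₂∼₂ ()) }
        ... | inj₂ (p , inj₂ a , st , carries) = inj₂ (p , a , st , carries)
        ... | inj₂ (_ , inj₁ _ , st , _) =
          case proj₂ (Step.succ st) cut (₁∼₂ , λ ()) of λ { (₂∼₂ ()) }

  -- Parallel composition between two states

  frame : State → Pomset Label → State → Pomset Label
  frame α M β = ⟪ α ⟫ · M · ⟪ β ⟫

  pattern bottom = inj₁ tt
  pattern middle m = inj₂ (inj₁ m)
  pattern top = inj₂ (inj₂ tt)

  module _ {M : Pomset Label} {α β : State} where
    private
      module W = Pomset (frame α M β)

    bottom-min : ∀ w → bottom W.≤ w
    bottom-min bottom   = ₁∼₁ refl
    bottom-min (inj₂ _) = ₁∼₂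

    top-max : ∀ w → w W.≤ top
    top-max bottom     = ₁∼₂
    top-max (middle _) = ₂∼₂ ₁∼₂
    top-max top        = ₂∼₂ (₂∼₂ refl)

    frame-bounded : Bounded (frame α M β)
    frame-bounded = record
      { lo = bottom ; hi = top ; lo-min = bottom-min ; hi-max = top-max
      ; lo-state = α , refl ; hi-state = β , refl }

    -- Both end nodes carry states, so the action of any step belongs to the middle. The bounds
    -- supplied by `Local` coincide with the two ends by antisymmetry.
    forward-frame : Local (frame α M β) → ∀ {w v n} → w ≢ top → valueOf (W.label w) v ≡ just n →
      ∃[ m ] ∃[ s ] Step (frame α M β) w (middle m) s ×
        Carries v (W.label w) (Pomset.label M m) (W.label s)
    forward-frame loc {w} w≢top d with Local.forward loc w _ _ d
    ... | inj₁ refl =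
      contradiction (Po.≤-antisym (frame α M β) (top-max w) (Local.hi-max loc top)) w≢top
    ... | inj₂ (middle m , s , st , carries) = m , s , st , carries
    ... | inj₂ (bottom , _ , step (_ , ()) _ _ _ _ , _)
    ... | inj₂ (top , _ , step (_ , ()) _ _ _ _ , _)

    backward-frame : Local (frame α M β) → ∀ {w v n} → w ≢ bottom → valueOf (W.label w) v ≡ just n →
      ∃[ p ] ∃[ m ] Step (frame α M β) p (middle m) w ×
        Carries v (W.label p) (Pomset.label M m) (W.label w)
    backward-frame loc {w} w≢bottom d with Local.backward loc w _ _ d
    ... | inj₁ refl =
      contradiction (Po.≤-antisym (frame α M β) (Local.lo-min loc bottom) (bottom-min w)) w≢bottom
    ... | inj₂ (p , middle m , st , carries) = p , m , st , carries
    ... | inj₂ (_ , bottom , step (_ , ()) _ _ _ _ , _)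
    ... | inj₂ (_ , top , step (_ , ()) _ _ _ _ , _)

  -- A full suborder of `M` closed upwards and downwards. Either side of a parallel composition is
  -- one, which lets both sides be treated at once.
  record Component (X M : Pomset Label) : Set where
    private
      module X = Pomset X
      module M = Pomset M
    field
      f      : X.Node → M.Node
      mono   : ∀ {x y} → x X.≤ y → f x M.≤ f y
      cancel : ∀ {x y} → f x M.≤ f y → x X.≤ y
      labels : ∀ x → X.label x ≡ M.label (f x)
      lower  : ∀ {x m} → m M.≤ f x → ∃[ y ] f y ≡ m
      upper  : ∀ {x m} → f x M.≤ m → ∃[ y ] f y ≡ m

  ∥-componentˡ : ∀ U V → Component U (U ∥ V)
  ∥-componentˡ U V = record
    { f = inj₁ ; mono = inj₁ ; cancel = λ { (inj₁ p) → p } ; labels = λ _ → refl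
    ; lower = λ { (inj₁ _) → _ , refl } ; upper = λ { (inj₁ _) → _ , refl } }

  ∥-componentʳ : ∀ U V → Component V (U ∥ V)
  ∥-componentʳ U V = record
    { f = inj₂ ; mono = inj₂ ; cancel = λ { (inj₂ p) → p } ; labels = λ _ → refl
    ; lower = λ { (inj₂ _) → _ , refl } ; upper = λ { (inj₂ _) → _ , refl } }

  module _ {X M : Pomset Label} (c : Component X M) {α α′ β β′ : State}
           (α⊑ : state α ⊑ state α′) (β⊑ : state β ⊑ state β′) where
    private
      module C = Component c
      module XF = Pomset (frame α X β)
      module MF = Pomset (frame α′ M β′)
      module XO = Po (frame α X β)
      module MO = Po (frame α′ M β′)

      g : XF.Node → MF.Node
      g bottom     = bottom
      g (middle x) = middle (C.f x)
      g top        = top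

      g-mono : ∀ {x y} → x XF.≤ y → g x MF.≤ g y
      g-mono {bottom} {y} _                      = bottom-min {M} {α′} {β′} (g y)
      g-mono {middle _} {middle _} (₂∼₂ (₁∼₁ p)) = ₂∼₂ (₁∼₁ (C.mono p))
      g-mono {middle x} {top} _                  = top-max {M} {α′} {β′} (g (middle x))
      g-mono {top} {top} _                       = MO.≤-refl
      g-mono {top} {middle _} (₂∼₂ ())

      g-cancel : ∀ {x y} → g x MF.≤ g y → x XF.≤ y
      g-cancel {bottom} {y} _                      = bottom-min {X} {α} {β} y
      g-cancel {middle _} {middle _} (₂∼₂ (₁∼₁ p)) = ₂∼₂ (₁∼₁ (C.cancel p))
      g-cancel {middle x} {top} _                  = top-max {X} {α} {β} (middle x)
      g-cancel {top} {top} _                       = XO.≤-refl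
      g-cancel {middle _} {bottom} ()
      g-cancel {top} {bottom} ()
      g-cancel {top} {middle _} (₂∼₂ ())

    -- Nodes comparable with an action of `X` are the two ends or, by the closure of the component,
    -- nodes of `X`; so the other components of `M` do not disturb predecessors and successors.
    frame-embedding : Embedding (frame α X β) (frame α′ M β′)
    frame-embedding = record
      { f = g
      ; mono = g-mono
      ; cancel = g-cancel
      ; labels = λ { bottom → α⊑ ; (middle x) → ⊑-reflexive (C.labels x) ; top → β⊑ }
      ; below = λ
        { {bottom} (_ , ())
        ; {top} (_ , ())
        ; {middle _} {bottom} _ _ → bottom , MO.≤-refl , ₁∼₂ , λ ()
        ; {middle _} {middle _} _ (₂∼₂ (₁∼₁ p) , ≢) → case C.lower p of λ
          { (y , refl) → middle y , MO.≤-refl , ₂∼₂ (₁∼₁ (C.cancel p)) , λ { refl → ≢ refl } }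
        ; {middle _} {top} _ (₂∼₂ () , _) }
      ; above = λ
        { {bottom} (_ , ())
        ; {top} (_ , ())
        ; {middle _} {bottom} _ (() , _)
        ; {middle _} {middle _} _ (₂∼₂ (₁∼₁ p) , ≢) → case C.upper p of λ
          { (y , refl) → middle y , MO.≤-refl , ₂∼₂ (₁∼₁ (C.cancel p)) , λ { refl → ≢ refl } }
        ; {middle _} {top} _ _ → top , MO.≤-refl , ₂∼₂ ₁∼₂ , λ () } }

  -- Unions of compatible states and gluing of parallel frames

  lookup-⊕ : ∀ α β v → lookup (α ⊕ β) v ≡ (lookup α v <∣> lookup β v)
  lookup-⊕ α β v = lookup-zipWith _<∣>_ v α β

  ⊑-⊕ˡ : ∀ α β → state α ⊑ state (α ⊕ β)
  ⊑-⊕ˡ α β = state λ v d → trans (lookup-⊕ α β v) (cong (_<∣> lookup β v) d)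

  -- Where both states are defined, `_<∣>_` returns the left value, which compatibility identifies
  -- with the right one.
  ⊑-⊕ʳ : ∀ {α β} → Compatible α β → state β ⊑ state (α ⊕ β)
  ⊑-⊕ʳ {α} {β} compat = state λ v {n} d → trans (lookup-⊕ α β v) (choose d (compat v))
    where
    choose : ∀ {a b : Maybe Val} {n} → b ≡ just n →
             (∀ {m n} → a ≡ just m → b ≡ just n → m ≡ n) → (a <∣> b) ≡ just n
    choose {just _} d agree = cong just (agree refl d)
    choose {nothing} d _    = d

  ⊕-defined : ∀ α β {v n} → lookup (α ⊕ β) v ≡ just n → lookup α v ≡ just n ⊎ lookup β v ≡ just n
  ⊕-defined α β {v} d with lookup α v | lookup β v | trans (sym (lookup-⊕ α β v)) d
  ... | just _  | _ | e = inj₁ e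
  ... | nothing | _ | e = inj₂ e

  -- The two frames overlap in their ends. A variable defined at an end is defined there in one of
  -- the two frames, and its step is found in that frame.
  Local-∥ : ∀ {U V α β γ δ} → Local (frame α U β) → Local (frame γ V δ) →
            Compatible α γ → Compatible β δ → Local (frame (α ⊕ γ) (U ∥ V) (β ⊕ δ))
  Local-∥ {U} {V} {α} {β} {γ} {δ} locU locV αγ βδ =
    glue X emb loc (frame-bounded {U ∥ V} {α ⊕ γ} {β ⊕ δ}) cover-< cover-act cover-hi cover-lo
    where
    W = frame (α ⊕ γ) (U ∥ V) (β ⊕ δ)
    module W = Pomset W
    module WO = Po W
    X : Bool → Pomset Label
    X true  = frame α U β
    X false = frame γ V δ
    emb : ∀ i → Embedding (X i) W
    emb true  = frame-embedding (∥-componentˡ U V) (⊑-⊕ˡ α γ) (⊑-⊕ˡ β δ)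
    emb false = frame-embedding (∥-componentʳ U V) (⊑-⊕ʳ αγ) (⊑-⊕ʳ βδ)
    loc : ∀ i → Local (X i)
    loc true  = locU
    loc false = locV
    module E i = Embedding (emb i)

    pair : ∀ i x y → IsStateLabel (W.label (E.f i x)) → IsStateLabel (W.label (E.f i y)) →
           E.f i x W.< E.f i y →
           ∃[ i′ ] ∃[ x′ ] ∃[ y′ ] E.f i x W.≤ E.f i′ x′ × E.f i′ y′ W.≤ E.f i y ×
             Pomset._<_ (X i′) x′ y′ ×
             IsStateLabel (Pomset.label (X i′) x′) × IsStateLabel (Pomset.label (X i′) y′)
    pair i x y st st′ x<y =
      i , x , y , WO.≤-refl , WO.≤-refl , reflect-< (emb i) x<y ,
      ⊑-state⁻ (E.labels i x) st , ⊑-state⁻ (E.labels i y) st′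

    cover-< : ∀ {s s′} → IsStateLabel (W.label s) → IsStateLabel (W.label s′) → s W.< s′ →
      ∃[ i ] ∃[ x ] ∃[ y ] s W.≤ E.f i x × E.f i y W.≤ s′ × Pomset._<_ (X i) x y ×
        IsStateLabel (Pomset.label (X i) x) × IsStateLabel (Pomset.label (X i) y)
    cover-< {bottom} {bottom} st st′ (_ , ≢) = contradiction refl ≢
    cover-< {bottom} {middle (inj₁ u)} st st′ lt = pair true bottom (middle u) st st′ lt
    cover-< {bottom} {middle (inj₂ v)} st st′ lt = pair false bottom (middle v) st st′ lt
    -- The ends belong to both frames; the left one is chosen to separate them.
    cover-< {bottom} {top} st st′ lt = pair true bottom top st st′ lt
    cover-< {middle (inj₁ u)} {middle (inj₁ u′)} st st′ lt = pair true (middle u) (middle u′) st st′ lt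
    cover-< {middle (inj₂ v)} {middle (inj₂ v′)} st st′ lt = pair false (middle v) (middle v′) st st′ lt
    cover-< {middle (inj₁ u)} {top} st st′ lt = pair true (middle u) top st st′ lt
    cover-< {middle (inj₂ v)} {top} st st′ lt = pair false (middle v) top st st′ lt
    cover-< {middle (inj₁ u)} {middle (inj₂ v)} st st′ (₂∼₂ (₁∼₁ ()) , _)
    cover-< {middle (inj₂ v)} {middle (inj₁ u)} st st′ (₂∼₂ (₁∼₁ ()) , _)
    cover-< {middle _} {bottom} st st′ (() , _)
    cover-< {top} {bottom} st st′ (() , _)
    cover-< {top} {middle _} st st′ (₂∼₂ () , _)
    cover-< {top} {top} st st′ (_ , ≢) = contradiction refl ≢

    cover-act : ∀ {a} → IsActionLabel (W.label a) → ∃[ i ] ∃[ x ] E.f i x ≡ a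
    cover-act {bottom} (_ , ())
    cover-act {top} (_ , ())
    cover-act {middle (inj₁ u)} _ = true , middle u , refl
    cover-act {middle (inj₂ v)} _ = false , middle v , refl

    locate : ∀ {u v n} → valueOf (W.label u) v ≡ just n →
      ∃[ i ] ∃[ x ] E.f i x ≡ u × valueOf (Pomset.label (X i) x) v ≡ just n
    locate {middle (inj₁ u)} d = true , middle u , refl , d
    locate {middle (inj₂ u)} d = false , middle u , refl , d
    locate {bottom} d with ⊕-defined α γ d
    ... | inj₁ e = true , bottom , refl , e
    ... | inj₂ e = false , bottom , refl , e
    locate {top} d with ⊕-defined β δ d
    ... | inj₁ e = true , top , refl , e
    ... | inj₂ e = false , top , refl , e

    hi-top : ∀ i → E.f i (Local.hi (loc i)) ≡ top
    hi-top true  = WO.≤-antisym (top-max {U ∥ V} {α ⊕ γ} {β ⊕ δ} _) (E.mono true (Local.hi-max locU top))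
    hi-top false = WO.≤-antisym (top-max {U ∥ V} {α ⊕ γ} {β ⊕ δ} _) (E.mono false (Local.hi-max locV top))

    lo-bottom : ∀ i → E.f i (Local.lo (loc i)) ≡ bottom
    lo-bottom true  = WO.≤-antisym (E.mono true (Local.lo-min locU bottom)) (bottom-min {U ∥ V} {α ⊕ γ} {β ⊕ δ} _)
    lo-bottom false = WO.≤-antisym (E.mono false (Local.lo-min locV bottom)) (bottom-min {U ∥ V} {α ⊕ γ} {β ⊕ δ} _)

    cover-hi : ∀ {u v n} → valueOf (W.label u) v ≡ just n →
      ∃[ i ] ∃[ x ] E.f i x ≡ u × valueOf (Pomset.label (X i) x) v ≡ just n ×
        (x ≡ Local.hi (loc i) → u ≡ top)
    cover-hi {u} d with locate {u} d
    ... | i , x , eq , e = i , x , eq , e , λ { refl → trans (sym eq) (hi-top i) }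

    cover-lo : ∀ {u v n} → valueOf (W.label u) v ≡ just n →
      ∃[ i ] ∃[ x ] E.f i x ≡ u × valueOf (Pomset.label (X i) x) v ≡ just n ×
        (x ≡ Local.lo (loc i) → u ≡ bottom)
    cover-lo {u} d with locate {u} d
    ... | i , x , eq , e = i , x , eq , e , λ { refl → trans (sym eq) (lo-bottom i) }

  -- Restriction of the end states of a frame to one parallel component

  module _ {P : Var → Set} (P? : ∀ v → Dec (P v)) where
    private
      keep : ∀ {Q : Set} → Dec Q → Maybe Val → Maybe Val
      keep (yes _) m = m
      keep (no _)  _ = nothing

    -- The restriction of the partial function `α` to the variables satisfying `P`.
    mask : State → State
    mask α = tabulate λ v → keep (P? v) (lookup α v)

    mask-⊑ : ∀ α → state (mask α) ⊑ state α
    mask-⊑ α = state λ v d → keep-just (P? v) (trans (sym (lookup∘tabulate _ v)) d)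
      where
      keep-just : ∀ {Q : Set} (q : Dec Q) {m n} → keep q m ≡ just n → m ≡ just n
      keep-just (yes _) d = d

    mask-intro : ∀ {α v n} → P v → lookup α v ≡ just n → lookup (mask α) v ≡ just n
    mask-intro {α} {v} p d = trans (lookup∘tabulate _ v) (keep-intro (P? v))
      where
      keep-intro : (q : Dec (P v)) → keep q (lookup α v) ≡ just _
      keep-intro (yes _) = d
      keep-intro (no ¬p) = contradiction p ¬p

    mask-elim : ∀ {α v n} → lookup (mask α) v ≡ just n → P v
    mask-elim {α} {v} d = keep-elim (P? v) (trans (sym (lookup∘tabulate _ v)) d)
      where
      keep-elim : (q : Dec (P v)) {n : Val} → keep q (lookup α v) ≡ just n → P v
      keep-elim (yes p) _ = p

  lookup-ext : ∀ {α β : State} → (∀ v → lookup α v ≡ lookup β v) → α ≡ β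
  lookup-ext {α} {β} eq =
    trans (sym (tabulate∘lookup α)) (trans (tabulate-cong eq) (tabulate∘lookup β))

  maybe-ext : ∀ {m m′ : Maybe Val} → (∀ {n} → m ≡ just n → m′ ≡ just n) →
              (∀ {n} → m′ ≡ just n → m ≡ just n) → m ≡ m′
  maybe-ext {just _}            f g = sym (f refl)
  maybe-ext {nothing} {just _}  f g = g refl
  maybe-ext {nothing} {nothing} f g = refl

  ⊑-compatible : ∀ {α β γ} → state α ⊑ state γ → state β ⊑ state γ → Compatible α β
  ⊑-compatible (state α⊑γ) (state β⊑γ) v d e = just-injective (trans (sym (α⊑γ v d)) (β⊑γ v e))

  ⊕-union : ∀ {α β γ} → state α ⊑ state γ → state β ⊑ state γ →
            (∀ {v n} → lookup γ v ≡ just n → lookup α v ≡ just n ⊎ lookup β v ≡ just n) → α ⊕ β ≡ γ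
  ⊕-union {α} {β} {γ} α⊑γ β⊑γ cover = lookup-ext λ v → maybe-ext
    (λ d → Sum.[ ⊑-value α⊑γ , ⊑-value β⊑γ ] (⊕-defined α β {v} d))
    (λ d → Sum.[ ⊑-value (⊑-⊕ˡ α β) , ⊑-value (⊑-⊕ʳ {α} {β} (⊑-compatible {α} {β} {γ} α⊑γ β⊑γ)) ] (cover {v} d))

  carries? : ∀ v p a s → Dec (Carries v p a s)
  carries? v p a s = assigns? a ⊎-dec ≡-dec Fin._≟_ (valueOf s v) (valueOf p v)
    where
    assigns? : ∀ l → Dec (∃[ k ] l ≡ act (v ← k))
    assigns? (state _)      = no λ ()
    assigns? (act (v′ ← k)) = map′ (λ { refl → k , refl }) (λ { (_ , refl) → refl }) (v Fin.≟ v′)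

  module _ {X M : Pomset Label} (c : Component X M) (x₀ : Pomset.Node X) {α β : State}
           (loc : Local (frame α M β)) where
    private
      W = frame α M β
      module X = Pomset X
      module M = Pomset M
      module W = Pomset W
      module L = Local loc
      module C = Component c

      mid : X.Node → W.Node
      mid x = middle (C.f x)

      reach-below : ∀ {b x} → IsActionLabel (W.label b) → b W.≤ mid x → ∃[ y ] mid y ≡ b
      reach-below {bottom} (_ , ()) _
      reach-below {middle _} _ (₂∼₂ (₁∼₁ p)) with C.lower p
      ... | y , refl = y , refl
      reach-below {top} (_ , ()) _

      reach-above : ∀ {b x} → IsActionLabel (W.label b) → mid x W.≤ b → ∃[ y ] mid y ≡ b
      reach-above {middle _} _ (₂∼₂ (₁∼₁ p)) with C.upper p
      ... | y , refl = y , refl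
      reach-above {top} (_ , ()) _

    -- The variables to be kept in the end states of the component. With this choice the forward
    -- condition at the bottom and the backward condition at the top hold by construction.
    Leaves Enters : Var → Set
    Leaves v = ∃[ x ] ∃[ s ] Step W bottom (mid x) s × Carries v (state α) (M.label (C.f x)) (W.label s)
    Enters v = ∃[ x ] ∃[ p ] Step W p (mid x) top × Carries v (W.label p) (M.label (C.f x)) (state β)

    -- Only the finitely many nodes `x` need a search: the predecessor and successor of an action
    -- exist and are unique, so what remains is to test the predecessor and decide `Carries`.
    leaves? : ∀ v → Dec (Leaves v)
    leaves? v = Po.any? X decide
      where
      decide : ∀ x → Dec (∃[ s ] Step W bottom (mid x) s × Carries v (state α) (M.label (C.f x)) (W.label s))
      decide x with state⊎act (M.label (C.f x))
      ... | inj₁ st = no λ { (_ , step act-x _ _ _ _ , _) → state≢act st act-x }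
      ... | inj₂ act-x with L.surrounded (mid x) act-x
      ... | inj₂ _ , _ , st = no λ { (_ , st′ , _) →
              case pred-unique {W} (Step.pred st) (Step.pred st′) of λ () }
      ... | bottom , s , st = map′ (λ carries → s , st , carries)
              (λ { (s′ , st′ , carries) → subst (λ s → Carries v (state α) (M.label (C.f x)) (W.label s))
                (succ-unique {W} (Step.succ st′) (Step.succ st)) carries })
              (carries? v (state α) (M.label (C.f x)) (W.label s))

    enters? : ∀ v → Dec (Enters v)
    enters? v = Po.any? X decide
      where
      decide : ∀ x → Dec (∃[ p ] Step W p (mid x) top × Carries v (W.label p) (M.label (C.f x)) (state β))
      decide x with state⊎act (M.label (C.f x))
      ... | inj₁ st = no λ { (_ , step act-x _ _ _ _ , _) → state≢act st act-x }
      ... | inj₂ act-x with L.surrounded (mid x) act-x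
      ... | _ , bottom , st = no λ { (_ , st′ , _) →
              case succ-unique {W} (Step.succ st) (Step.succ st′) of λ () }
      ... | _ , middle _ , st = no λ { (_ , st′ , _) →
              case succ-unique {W} (Step.succ st) (Step.succ st′) of λ () }
      ... | p , top , st = map′ (λ carries → p , st , carries)
              (λ { (p′ , st′ , carries) → subst (λ p → Carries v (W.label p) (M.label (C.f x)) (state β))
                (pred-unique {W} (Step.pred st′) (Step.pred st)) carries })
              (carries? v (W.label p) (M.label (C.f x)) (state β))

    entry exit : State
    entry = mask leaves? α
    exit  = mask enters? β

    -- Masking loses nothing that the component uses: a value taken over unchanged from the bottom
    -- is carried by that very step and passes `leaves?`, and a value carried into the top passes
    -- `enters?`. Inner nodes keep their labels.
    Local-component : Local (frame entry X exit)
    Local-component = restrict emb loc (frame-bounded {X} {entry} {exit}) separated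
      (λ {p} {a} {s} → written {p} {a} {s}) (λ {p} {a} {s} → read {p} {a} {s})
      (λ {u} → next {u}) (λ {u} → previous {u})
      where
      XF = frame entry X exit
      module XF = Pomset XF
      module WO = Po W
      emb : Embedding XF W
      emb = frame-embedding c (mask-⊑ leaves? α) (mask-⊑ enters? β)
      open Embedding emb

      between : ∀ {s s′} → IsStateLabel (XF.label s) → IsStateLabel (XF.label s′) → s XF.< s′ →
                ∃[ a ] IsActionLabel (W.label a) × f s W.< a × a W.< f s′
      between {s} {s′} st st′ s<s′ = L.separated (f s) (f s′)
        (⊑-state (labels s) st) (⊑-state (labels s′) st′) (embed-< emb s<s′)

      pull : ∀ {s s′ w} → ∃[ y ] mid y ≡ w → IsActionLabel (W.label w) → f s W.< w → w W.< f s′ →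
             ∃[ a ] IsActionLabel (XF.label a) × s XF.< a × a XF.< s′
      pull (y , refl) act-a s<a a<s′ =
        middle y , reflect-act emb {middle y} act-a , reflect-< emb s<a , reflect-< emb a<s′

      separated : Separated XF
      separated (middle x) s′ st st′ s<s′ =
        let a , act-a , s<a , a<s′ = between {middle x} {s′} st st′ s<s′ in
        pull {middle x} {s′} (reach-above {a} {x} act-a (proj₁ s<a)) act-a s<a a<s′
      separated s (middle x) st st′ s<s′ =
        let a , act-a , s<a , a<s′ = between {s} {middle x} st st′ s<s′ in
        pull {s} {middle x} (reach-below {a} {x} act-a (proj₁ a<s′)) act-a s<a a<s′
      -- The action separating the ends in `M` may lie in another component, so one is found through
      -- `x₀`: either `x₀` is an action, or it is a state and is separated from the bottom within
      -- `X`.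
      separated bottom top _ _ _ with state⊎act (X.label x₀)
      ... | inj₂ act-x = middle x₀ , act-x , (₁∼₂ , λ ()) , (₂∼₂ ₁∼₂ , λ ())
      ... | inj₁ st with separated bottom (middle x₀) (_ , refl) st (₁∼₂ , λ ())
      ... | a , act-a , lo<a , a<x =
        a , act-a , lo<a , Po.<-≤-trans XF a<x (top-max {X} {entry} {exit} (middle x₀))
      separated bottom bottom _ _ (_ , ≢) = contradiction refl ≢
      separated top top _ _ (_ , ≢) = contradiction refl ≢
      separated top bottom _ _ (() , _)

      written : ∀ {p a s v n} → Step XF p a s →
        Carries v (W.label (f p)) (W.label (f a)) (W.label (f s)) →
        valueOf (W.label (f s)) v ≡ just n → valueOf (XF.label s) v ≡ just n
      written {s = bottom} st _ _ = case proj₁ (proj₁ (Step.succ st)) of λ { (₁∼₁ refl) →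
        contradiction refl (proj₂ (proj₁ (Step.succ st))) }
      written {s = middle x} {v} {n} _ _ d = subst (λ l → valueOf l v ≡ just n) (sym (C.labels x)) d
      written {p} {middle x} {top} {v} st carries d =
        mask-intro enters? {β} {v} (x , f p , embed-step emb st , carries) d
      written {a = bottom} st _ _ = contradiction (Step.action st) λ { (_ , ()) }
      written {a = top} st _ _ = contradiction (Step.action st) λ { (_ , ()) }

      read : ∀ {p a s v n} → Step XF p a s → valueOf (W.label (f s)) v ≡ valueOf (W.label (f p)) v →
        valueOf (W.label (f p)) v ≡ just n → valueOf (XF.label p) v ≡ just n
      read {bottom} {middle x} {s} {v} st eq d =
        mask-intro leaves? {α} {v} (x , f s , embed-step emb st , inj₂ eq) d
      read {middle x} {v = v} {n} _ _ d = subst (λ l → valueOf l v ≡ just n) (sym (C.labels x)) d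
      read {a = bottom} st _ _ = contradiction (Step.action st) λ { (_ , ()) }
      read {a = top} st _ _ = contradiction (Step.action st) λ { (_ , ()) }
      read {top} {middle _} st _ _ = case proj₁ (proj₁ (Step.pred st)) of λ { (₂∼₂ ()) }

      next : ∀ {u v n} → valueOf (XF.label u) v ≡ just n →
        u ≡ top ⊎ ∃[ a ] ∃[ s ] Step W (f u) (f a) s ×
          Carries v (W.label (f u)) (W.label (f a)) (W.label s)
      next {top} _ = inj₁ refl
      next {bottom} {v} d with mask-elim leaves? {α} {v} d
      ... | x , s , st , carries = inj₂ (middle x , s , st , carries)
      next {middle x} {v} d
        with forward-frame {M} {α} {β} loc {mid x} {v} (λ ()) (⊑-value (labels (middle x)) d)
      ... | _ , s , st , carries
        with reach-above {_} {x} (Step.action st) (proj₁ (proj₁ (Step.pred st)))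
      ... | y , refl = inj₂ (middle y , s , st , carries)

      previous : ∀ {u v n} → valueOf (XF.label u) v ≡ just n →
        u ≡ bottom ⊎ ∃[ p ] ∃[ a ] Step W p (f a) (f u) ×
          Carries v (W.label p) (W.label (f a)) (W.label (f u))
      previous {bottom} _ = inj₁ refl
      previous {top} {v} d with mask-elim enters? {β} {v} d
      ... | x , p , st , carries = inj₂ (p , middle x , st , carries)
      previous {middle x} {v} d
        with backward-frame {M} {α} {β} loc {mid x} {v} (λ ()) (⊑-value (labels (middle x)) d)
      ... | p , _ , st , carries
        with reach-below {_} {x} (Step.action st) (proj₁ (proj₁ (Step.succ st)))
      ... | y , refl = inj₂ (p , middle y , st , carries)

  module _ {U V : Pomset Label} (u₀ : Pomset.Node U) (v₀ : Pomset.Node V) {α β : State}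
           (loc : Local (frame α (U ∥ V) β)) where
    private
      cˡ = ∥-componentˡ U V
      cʳ = ∥-componentʳ U V
      leavesˡ = leaves? cˡ u₀ {α} {β} loc
      leavesʳ = leaves? cʳ v₀ {α} {β} loc
      entersˡ = enters? cˡ u₀ {α} {β} loc
      entersʳ = enters? cʳ v₀ {α} {β} loc

      -- The forward step for `v` out of the bottom has its action in `U` or in `V`, and that side
      -- keeps `v`.
      cover-entry : ∀ {v n} → lookup α v ≡ just n →
                    lookup (mask leavesˡ α) v ≡ just n ⊎ lookup (mask leavesʳ α) v ≡ just n
      cover-entry {v} d with forward-frame {U ∥ V} {α} {β} loc {bottom} {v} (λ ()) d
      ... | inj₁ u , s , st , carries = inj₁ (mask-intro leavesˡ {α} {v} (u , s , st , carries) d)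
      ... | inj₂ u , s , st , carries = inj₂ (mask-intro leavesʳ {α} {v} (u , s , st , carries) d)

      cover-exit : ∀ {v n} → lookup β v ≡ just n →
                   lookup (mask entersˡ β) v ≡ just n ⊎ lookup (mask entersʳ β) v ≡ just n
      cover-exit {v} d with backward-frame {U ∥ V} {α} {β} loc {top} {v} (λ ()) d
      ... | p , inj₁ u , st , carries = inj₁ (mask-intro entersˡ {β} {v} (u , p , st , carries) d)
      ... | p , inj₂ u , st , carries = inj₂ (mask-intro entersʳ {β} {v} (u , p , st , carries) d)

    -- Restrictions of one state are compatible, and here their union restores it because every
    -- variable is kept on some side. The hypotheses range over all end states since masking changes
    -- them.
    Guarded-∥ : (∀ {α β} → Local (frame α U β) → Guarded (frame α U β)) →
                (∀ {α β} → Local (frame α V β) → Guarded (frame α V β)) →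
                Guarded (frame α (U ∥ V) β)
    Guarded-∥ guardedU guardedV = subst Guarded
      (cong₂ (λ α β → frame α (U ∥ V) β)
        (⊕-union (mask-⊑ leavesˡ α) (mask-⊑ leavesʳ α) cover-entry)
        (⊕-union (mask-⊑ entersˡ β) (mask-⊑ entersʳ β) cover-exit))
      (g-par {U} {V} {mask leavesˡ α} {mask entersˡ β} {mask leavesʳ α} {mask entersʳ β}
        (guardedU (Local-component cˡ u₀ {α} {β} loc)) (guardedV (Local-component cʳ v₀ {α} {β} loc))
        (⊑-compatible {mask leavesˡ α} {mask leavesʳ α} {α} (mask-⊑ leavesˡ α) (mask-⊑ leavesʳ α))
        (⊑-compatible {mask entersˡ β} {mask entersʳ β} {β} (mask-⊑ entersˡ β) (mask-⊑ entersʳ β)))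

  -- Guarded pomsets satisfy the conditions

  Local-⟪⟫ : ∀ α → Local ⟪ α ⟫
  Local-⟪⟫ α = record
    { bounded = record
      { lo = tt ; hi = tt ; lo-min = λ _ → refl ; hi-max = λ _ → refl
      ; lo-state = α , refl ; hi-state = α , refl }
    ; separated = λ _ _ _ _ (_ , ≢) → contradiction refl ≢
    ; surrounded = λ { _ (_ , ()) }
    ; sound = λ _ _ ()
    ; forward = λ _ _ _ _ → inj₁ refl
    ; backward = λ _ _ _ _ → inj₁ refl }

  assign-sound : ∀ {α β} a → assign α a ≡ just β → Sound a (state α) (state β)
  assign-sound {α} (v ← val n) refl = lookup∘update v α (just n)
  assign-sound {α} (v ← var v′) eq with lookup α v′ in d
  assign-sound {α} (v ← var v′) refl | just n with v′ Fin.≟ v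
  -- In `v ← v` the source is itself overwritten, with the value it already had.
  ... | yes refl = n , refl , lookup∘update v α (just n) , lookup∘update v α (just n)
  ... | no v′≢v  = n , refl , trans (lookup∘update′ v′≢v α (just n)) d , lookup∘update v α (just n)

  assign-carries : ∀ {α β} a v → assign α a ≡ just β → Carries v (state α) (act a) (state β)
  assign-carries {α} (w ← k) v eq with v Fin.≟ w
  assign-carries {α} (w ← k) v eq | yes refl = inj₁ (k , refl)
  assign-carries {α} (w ← val n) v refl | no v≢w = inj₂ (lookup∘update′ v≢w α (just n))
  assign-carries {α} (w ← var v′) v eq | no v≢w with lookup α v′
  assign-carries {α} (w ← var v′) v refl | no v≢w | just n = inj₂ (lookup∘update′ v≢w α (just n))

  update-unique : ∀ {α β : State} {w n} → lookup β w ≡ just n →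
                  (∀ v → v ≢ w → lookup β v ≡ lookup α v) → (α [ w ]≔ just n) ≡ β
  update-unique {α} {β} {w} {n} d agree = lookup-ext pointwise
    where
    pointwise : ∀ v → lookup (α [ w ]≔ just n) v ≡ lookup β v
    pointwise v with v Fin.≟ w
    ... | yes refl = trans (lookup∘update v α (just n)) (sym d)
    ... | no v≢w   = trans (lookup∘update′ v≢w α (just n)) (sym (agree v v≢w))

  -- `Sound` fixes the new value of the target, and at any other variable `Carries` can only mean
  -- that the value is kept; so `β` agrees with the update pointwise.
  assign-complete : ∀ {α β} a → Sound a (state α) (state β) →
                    (∀ v → Carries v (state α) (act a) (state β)) → assign α a ≡ just β
  assign-complete {α} {β} (w ← k) sound carries = complete k sound unchanged
    where
    unchanged : ∀ v → v ≢ w → lookup β v ≡ lookup α v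
    unchanged v v≢w with carries v
    ... | inj₁ (_ , refl) = contradiction refl v≢w
    ... | inj₂ eq = eq
    complete : ∀ k → Sound (w ← k) (state α) (state β) →
               (∀ v → v ≢ w → lookup β v ≡ lookup α v) → assign α (w ← k) ≡ just β
    complete (val n) d agree = cong just (update-unique d agree)
    complete (var v′) (n , d , _ , e) agree rewrite d = cong just (update-unique e agree)

  module _ {α β : State} {a : Act} where
    private
      W = frame α ⟨ act a ⟩ β

    step-letter : ∀ {p b s} → Step W p b s → p ≡ bottom × b ≡ middle tt × s ≡ top
    step-letter {_} {bottom} (step (_ , ()) _ _ _ _)
    step-letter {_} {top} (step (_ , ()) _ _ _ _)
    step-letter {middle _} {middle _} (step _ _ _ (_ , ()) _)
    step-letter {top} {middle _} (step _ ((₂∼₂ () , _) , _) _ _ _)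
    step-letter {bottom} {middle _} {bottom} (step _ _ ((() , _) , _) _ _)
    step-letter {bottom} {middle _} {middle _} (step _ _ _ _ (_ , ()))
    step-letter {bottom} {middle _} {top} _ = refl , refl , refl

    letter-step : Step W bottom (middle tt) top
    letter-step = step (a , refl)
      ((₁∼₂ , λ ()) , λ
        { bottom _ → ₁∼₁ refl
        ; (middle _) (_ , ≢) → contradiction refl ≢
        ; top (₂∼₂ () , _) })
      ((₂∼₂ ₁∼₂ , λ ()) , λ
        { bottom (() , _)
        ; (middle _) (_ , ≢) → contradiction refl ≢
        ; top _ → ₂∼₂ (₂∼₂ refl) })
      (α , refl) (β , refl)

    Local-assign : assign α a ≡ just β → Local W
    Local-assign eq = record
      { bounded = frame-bounded {⟨ act a ⟩} {α} {β}
      ; separated = separated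
      ; surrounded = λ
        { bottom (_ , ()) ; (middle _) _ → bottom , top , letter-step ; top (_ , ()) }
      ; sound = λ x st e → sound x (step-letter st) e
      ; forward = λ
        { bottom v _ _ → inj₂ (middle tt , top , letter-step , assign-carries a v eq)
        ; top _ _ _ → inj₁ refl }
      ; backward = λ
        { bottom _ _ _ → inj₁ refl
        ; top v _ _ → inj₂ (bottom , middle tt , letter-step , assign-carries a v eq) } }
      where
      open Pomset W
      separated : Separated W
      separated bottom bottom _ _ (_ , ≢) = contradiction refl ≢
      separated bottom top _ _ _ = middle tt , (a , refl) , (₁∼₂ , λ ()) , (₂∼₂ ₁∼₂ , λ ())
      separated (middle _) _ (_ , ()) _ _
      separated _ (middle _) _ (_ , ()) _
      separated top bottom _ _ (() , _)
      separated top top _ _ (_ , ≢) = contradiction refl ≢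
      sound : ∀ {p b s} x → p ≡ bottom × b ≡ middle tt × s ≡ top → label b ≡ act x →
              Sound x (label p) (label s)
      sound _ (refl , refl , refl) refl = assign-sound a eq

    -- There is only one step. It carries the variables of `α` by the forward condition and those of
    -- `β` by the backward condition; a variable undefined in both is unchanged.
    assign-Local : Local W → assign α a ≡ just β
    assign-Local loc = assign-complete a (Local.sound loc a letter-step refl) carries
      where
      carries : ∀ v → Carries v (state α) (act a) (state β)
      carries v with lookup α v in eα | lookup β v in eβ
      ... | just _ | _ with forward-frame {⟨ act a ⟩} {α} {β} loc {bottom} (λ ()) eα
      ...   | _ , _ , st , c with refl , refl , refl ← step-letter st =
        Sum.map₂ (λ e → trans (sym eβ) (trans e eα)) c
      carries v | nothing | just _ with backward-frame {⟨ act a ⟩} {α} {β} loc {top} (λ ()) eβ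
      ...   | _ , _ , st , c with refl , refl , refl ← step-letter st =
        Sum.map₂ (λ e → trans (sym eβ) (trans e eα)) c
      carries v | nothing | nothing = inj₂ refl

  Guarded⇒Local : ∀ {U} → Guarded U → Local U
  Guarded⇒Local (g-state α)       = Local-⟪⟫ α
  Guarded⇒Local (g-act eq)        = Local-assign eq
  Guarded⇒Local (g-seq {U} {V} {α} u v)     = Local-· U V α (Guarded⇒Local u) (Guarded⇒Local v)
  Guarded⇒Local (g-par {U} {V} {α} {β} {γ} {δ} u v αγ βδ) =
    Local-∥ {U} {V} {α} {β} {γ} {δ} (Guarded⇒Local u) (Guarded⇒Local v) αγ βδ
  Guarded⇒Local (resp-≅ e u)      = Local-resp-≃ (≅⇒≃ e) (Guarded⇒Local u)

  -- Series-parallel pomsets satisfying the conditions are guarded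

  module _ {P S : Pomset Label} {α β : State} (loc : Local (frame α (P · S) β)) where
    private
      module P = Pomset P
      module S = Pomset S
      module L = Local loc

    -- The successor of `m` is not in `P` by maximality, and it is not the top because `S` has a
    -- node, which lies above `m`. So it lies in `S`, and as all of `S` is above `m` it is the
    -- minimum there.
    successor-of-maximal : ∀ {m} → IsMaximal P m → IsActionLabel (P.label m) → S.Node →
                           ∃[ y ] Minimum S._≤_ y × IsStateLabel (S.label y)
    successor-of-maximal {m} max act-m y₀ with L.surrounded (middle (inj₁ m)) act-m
    ... | _ , middle (inj₂ y) , step _ _ (_ , least) _ st =
      y , (λ y′ → case least (middle (inj₂ y′)) (₂∼₂ (₁∼₁ ₁∼₂) , λ ()) of λ
        { (₂∼₂ (₁∼₁ (₂∼₂ p))) → p }) , st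
    ... | _ , middle (inj₁ x) , step _ _ ((₂∼₂ (₁∼₁ (₁∼₁ p)) , ≢) , _) _ _ with refl ← max p =
      contradiction refl ≢
    ... | _ , bottom , step _ _ ((() , _) , _) _ _
    ... | _ , top , step _ _ (_ , least) _ _ =
      case least (middle (inj₂ y₀)) (₂∼₂ (₁∼₁ ₁∼₂) , λ ()) of λ { (₂∼₂ ()) }

    -- If `y` is a state, nothing lies between `m` and `y` to separate them. If `y` is an action,
    -- its predecessor is in `P` by minimality of `y` and above both `m` and `m′`, so by maximality
    -- it equals both.
    ¬two-maximal-states : ∀ {m m′ y} → IsMaximal P m → IsMaximal P m′ → m ≢ m′ →
                          IsStateLabel (P.label m) → IsMinimal S y → ¬ IsStateLabel (P.label m′)
    ¬two-maximal-states {m} {m′} {y} max max′ m≢m′ st min st′ with state⊎act (S.label y)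
    ... | inj₁ st-y
      with L.separated (middle (inj₁ m)) (middle (inj₂ y)) st st-y (₂∼₂ (₁∼₁ ₁∼₂) , λ ())
    ... | middle (inj₁ _) , _ , (₂∼₂ (₁∼₁ (₁∼₁ p)) , ≢) , _ with refl ← max p = contradiction refl ≢
    ... | middle (inj₂ _) , _ , _ , (₂∼₂ (₁∼₁ (₂∼₂ p)) , ≢) with refl ← min p = contradiction refl ≢
    ... | bottom , (_ , ()) , _
    ... | top , (_ , ()) , _
    ¬two-maximal-states {m} {m′} {y} max max′ m≢m′ st min st′ | inj₂ act-y
      with L.surrounded (middle (inj₂ y)) act-y
    ... | p , _ , step _ (p<y , greatest) _ _ _
      with p | p<y | greatest (middle (inj₁ m)) (₂∼₂ (₁∼₁ ₁∼₂) , λ ())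
             | greatest (middle (inj₁ m′)) (₂∼₂ (₁∼₁ ₁∼₂) , λ ())
    ... | middle (inj₁ _) | _ | ₂∼₂ (₁∼₁ (₁∼₁ p)) | ₂∼₂ (₁∼₁ (₁∼₁ p′)) = m≢m′ (trans (sym (max p)) (max′ p′))
    ... | middle (inj₂ _) | ₂∼₂ (₁∼₁ (₂∼₂ p)) , ≢ | _ | _ with refl ← min p = contradiction refl ≢
    ... | bottom | _ | () | _
    ... | top | ₂∼₂ () , _ | _ | _

  -- Only the bottom lies strictly below `x`, so no action separates the two states.
  ¬minimal-state : ∀ {M α β x} → Local (frame α M β) → IsMinimal M x → ¬ IsStateLabel (Pomset.label M x)
  ¬minimal-state {M} {α} {β} {x} loc min st
    with Local.separated loc bottom (middle x) (α , refl) st (₁∼₂ , λ ())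
  ... | bottom , (_ , ()) , _
  ... | top , (_ , ()) , _
  ... | middle _ , _ , _ , (₂∼₂ (₁∼₁ p) , ≢) with refl ← min p = contradiction refl ≢

  ¬maximal-state : ∀ {M α β x} → Local (frame α M β) → IsMaximal M x → ¬ IsStateLabel (Pomset.label M x)
  ¬maximal-state {M} {α} {β} {x} loc max st
    with Local.separated loc (middle x) top st (β , refl) (₂∼₂ ₁∼₂ , λ ())
  ... | bottom , (_ , ()) , _
  ... | top , (_ , ()) , _
  ... | middle _ , _ , (₂∼₂ (₁∼₁ p) , ≢) , _ with refl ← max p = contradiction refl ≢

  -- A letter has to be an action, since a state would be minimal in the middle. For a parallel
  -- composition one maximal node is taken from each side: an action among them has its successor in
  -- `s`, and two states are excluded.
  state-after-prime : ∀ p s {α β} → Local (frame α (⟦ p ⟧ₚ · ⟦ s ⟧) β) →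
    ∃[ y ] Minimum (Pomset._≤_ ⟦ s ⟧) y × IsStateLabel (Pomset.label ⟦ s ⟧ y)
  state-after-prime (letter l) s {α} {β} loc with state⊎act l
  ... | inj₁ st = ⊥-elim (¬minimal-state {⟨ l ⟩ · ⟦ s ⟧} {α} {β} {inj₁ tt} loc (λ { (₁∼₁ _) → refl }) st)
  ... | inj₂ act-l = successor-of-maximal {⟨ l ⟩} {⟦ s ⟧} {α} {β} loc {tt} (λ _ → refl) act-l (proj₁ (minimal s))
  state-after-prime (par t u) s {α} {β} loc
    with m , max ← maximal t | m′ , max′ ← maximal u
    with state⊎act (Pomset.label ⟦ t ⟧ m) | state⊎act (Pomset.label ⟦ u ⟧ m′)
  ... | inj₂ act-m | _ =
    successor-of-maximal {⟦ t ⟧ ∥ ⟦ u ⟧} {⟦ s ⟧} {α} {β} loc {inj₁ m}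
      (λ { (inj₁ p) → cong inj₁ (max p) }) act-m (proj₁ (minimal s))
  ... | inj₁ _ | inj₂ act-m′ =
    successor-of-maximal {⟦ t ⟧ ∥ ⟦ u ⟧} {⟦ s ⟧} {α} {β} loc {inj₂ m′}
      (λ { (inj₂ p) → cong inj₂ (max′ p) }) act-m′ (proj₁ (minimal s))
  ... | inj₁ st | inj₁ st′ = ⊥-elim
    (¬two-maximal-states {⟦ t ⟧ ∥ ⟦ u ⟧} {⟦ s ⟧} {α} {β} loc {inj₁ m} {inj₂ m′}
      (λ { (inj₁ p) → cong inj₁ (max p) }) (λ { (inj₂ p) → cong inj₂ (max′ p) }) (λ ())
      st (proj₂ (minimal s)) st′)

  minimum-state : ∀ p {x} → Minimum (Pomset._≤_ ⟦ p ⟧ₚ) x → IsStateLabel (Pomset.label ⟦ p ⟧ₚ x) →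
                  ∃[ γ ] p ≡ letter (state γ)
  minimum-state p min st with min⇒letter p min
  minimum-state _ _ (γ , refl) | _ , refl = γ , refl

  maximum-state : ∀ p {x} → Maximum (Pomset._≤_ ⟦ p ⟧ₚ) x → IsStateLabel (Pomset.label ⟦ p ⟧ₚ x) →
                  ∃[ γ ] p ≡ letter (state γ)
  maximum-state p max st with max⇒letter p max
  maximum-state _ _ (γ , refl) | _ , refl = γ , refl

  -- As `p` has a node, the minimum of the product lies in `p`, and a prime with a minimum is a
  -- letter.
  minimum-state-· : ∀ p {S x} → Minimum (Pomset._≤_ (⟦ p ⟧ₚ · S)) x →
                    IsStateLabel (Pomset.label (⟦ p ⟧ₚ · S) x) → ∃[ γ ] p ≡ letter (state γ)
  minimum-state-· p {x = inj₁ _} min st = minimum-state p (λ y → case min (inj₁ y) of λ { (₁∼₁ q) → q }) st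
  minimum-state-· p {x = inj₂ _} min st = case min (inj₁ (proj₁ (minimalₚ p))) of λ ()

  maximum-state-· : ∀ p {S x} → Maximum (Pomset._≤_ (S · ⟦ p ⟧ₚ)) x →
                    IsStateLabel (Pomset.label (S · ⟦ p ⟧ₚ) x) → ∃[ γ ] p ≡ letter (state γ)
  maximum-state-· p {x = inj₂ _} max st = maximum-state p (λ y → case max (inj₂ y) of λ { (₂∼₂ q) → q }) st
  maximum-state-· p {x = inj₁ _} max st = case max (inj₂ (proj₁ (minimalₚ p))) of λ ()

  -- Induction over normal forms

  frame-· : ∀ α U γ V β → frame α (U · ⟪ γ ⟫ · V) β ≃ (⟪ α ⟫ · U) · ⟪ γ ⟫ · (V · ⟪ β ⟫)
  frame-· α U γ V β = ≃-trans
    (·-cong {U = ⟪ α ⟫} {⟪ α ⟫} ≃-refl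
      (≃-trans (·-assoc U (⟪ γ ⟫ · V) ⟪ β ⟫)
        (·-cong (≃-refl {U = U}) (·-assoc ⟪ γ ⟫ V ⟪ β ⟫))))
    (≃-sym (·-assoc ⟪ α ⟫ U (⟪ γ ⟫ · V · ⟪ β ⟫)))

  -- After reassociation `γ` stands between two halves as in `g-seq`. Each half inherits the
  -- conditions and is again a frame, now with `γ` as one of its ends.
  Guarded-· : ∀ {α U γ V β} → (Local (frame α U γ) → Guarded (frame α U γ)) →
              (Local (frame γ V β) → Guarded (frame γ V β)) →
              Local (frame α (U · ⟪ γ ⟫ · V) β) → Guarded (frame α (U · ⟪ γ ⟫ · V) β)
  Guarded-· {α} {U} {γ} {V} {β} guardedˡ guardedʳ loc =
    resp-≅ (≃⇒≅ {V = frame α (U · ⟪ γ ⟫ · V) β} (≃-sym (frame-· α U γ V β)))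
      (g-seq {⟪ α ⟫ · U} {V · ⟪ β ⟫} {γ}
        (resp-≅ (≃⇒≅ {V = (⟪ α ⟫ · U) · ⟪ γ ⟫} (≃-sym assoc))
          (guardedˡ (Local-resp-≃ assoc (Local-·ˡ (⟪ α ⟫ · U) (V · ⟪ β ⟫) γ loc′))))
        (guardedʳ (Local-·ʳ (⟪ α ⟫ · U) (V · ⟪ β ⟫) γ loc′)))
    where
    assoc : (⟪ α ⟫ · U) · ⟪ γ ⟫ ≃ frame α U γ
    assoc = ·-assoc ⟪ α ⟫ U ⟪ γ ⟫
    loc′ : Local ((⟪ α ⟫ · U) · ⟪ γ ⟫ · (V · ⟪ β ⟫))
    loc′ = Local-resp-≃ (frame-· α U γ V β) loc

  Guarded-frameₚ : ∀ p {α β} → Local (frame α ⟦ p ⟧ₚ β) → Guarded (frame α ⟦ p ⟧ₚ β)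
  Guarded-frame  : ∀ s {α β} → Local (frame α ⟦ s ⟧ β) → Guarded (frame α ⟦ s ⟧ β)
  Guarded-frameₚ (letter (act a)) loc = g-act (assign-Local loc)
  Guarded-frameₚ (letter (state γ)) {α} {β} loc =
    ⊥-elim (¬minimal-state {⟪ γ ⟫} {α} {β} {tt} loc (λ _ → refl) (γ , refl))
  Guarded-frameₚ (par s t) {α} {β} loc =
    Guarded-∥ {⟦ s ⟧} {⟦ t ⟧} (proj₁ (minimal s)) (proj₁ (minimal t)) {α} {β} loc
      (Guarded-frame s) (Guarded-frame t)
  Guarded-frame [ p ] loc = Guarded-frameₚ p loc
  Guarded-frame (p ∷ [ q ]) {α} {β} loc with state-after-prime p [ q ] {α} {β} loc
  ... | y , min , st with minimum-state q min st
  -- A state as last prime of the middle would lie directly below the top.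
  ... | γ , refl = ⊥-elim (¬maximal-state {⟦ p ⟧ₚ · ⟪ γ ⟫} {α} {β} {inj₂ tt} loc (λ { (₂∼₂ _) → refl }) (γ , refl))
  Guarded-frame (p ∷ q ∷ s) {α} {β} loc with state-after-prime p (q ∷ s) {α} {β} loc
  ... | y , min , st with minimum-state-· q {⟦ s ⟧} min st
  ... | γ , refl = Guarded-· {α} {⟦ p ⟧ₚ} {γ} {⟦ s ⟧} {β} (Guarded-frameₚ p) (Guarded-frame s) loc

  Guarded-chain : ∀ s → Local ⟦ s ⟧ → Guarded ⟦ s ⟧
  Guarded-chain [ p ] loc with minimum-state p (Local.lo-min loc) (Local.lo-state loc)
  ... | α , refl = g-state α
  Guarded-chain (p ∷ s) loc
    with minimum-state-· p {⟦ s ⟧} (Local.lo-min loc) (Local.lo-state loc) | snocView s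
  ... | α , refl | single q
    with maximum-state-· q {⟪ α ⟫} (Local.hi-max loc) (Local.hi-state loc)
  -- A chain of just two states has no action to separate them.
  ... | β , refl with Local.separated loc (inj₁ tt) (inj₂ tt) (α , refl) (β , refl) (₁∼₂ , λ ())
  ... | inj₁ _ , (_ , ()) , _
  ... | inj₂ _ , (_ , ()) , _
  Guarded-chain (_ ∷ s) loc | α , refl | snoc t q e
    with loc′ ← Local-resp-≃ (·-cong {U = ⟪ α ⟫} {⟪ α ⟫} ≃-refl e) loc
    -- Regrouped with `q` as right factor, the pomset has its maximum in `q`. Hence `q` is a state
    -- letter, and what remains is a frame around `t`.
    with maximum-state-· q {⟪ α ⟫ · ⟦ t ⟧}
           (Local.hi-max (Local-resp-≃ (≃-sym (·-assoc ⟪ α ⟫ ⟦ t ⟧ ⟦ q ⟧ₚ)) loc′))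
           (Local.hi-state (Local-resp-≃ (≃-sym (·-assoc ⟪ α ⟫ ⟦ t ⟧ ⟦ q ⟧ₚ)) loc′))
  ... | β , refl =
    resp-≅ (≃⇒≅ (≃-sym (·-cong {U = ⟪ α ⟫} {⟪ α ⟫} ≃-refl e))) (Guarded-frame t {α} {β} loc′)

  Local⇒Guarded : ∀ {U} → SP U → Local U → Guarded U
  Local⇒Guarded sp loc with SP⇒Chain sp
  -- The empty pomset is ruled out by the existence of a lower bound.
  ... | inj₁ empty   = ⊥-elim (empty (Local.lo loc))
  ... | inj₂ (s , e) = resp-≅ (≃⇒≅ e) (Guarded-chain s (Local-resp-≃ (≃-sym e) loc))

theorem5p9 : (nVar nVal : ℕ) → let open Guards nVar nVal in
             (U : Pomset Label) → SP U → Guarded U ⇔ Conditions U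
theorem5p9 nVar nVal U sp = mk⇔
  (λ g → Local⇒Conditions (Guarded⇒Local g))
  (λ c → Local⇒Guarded sp (Conditions⇒Local c))
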